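{- For bijective structures given by presentations with a single generator $a$ and a single relator (a single identity $t(a)=a$), each elementary first-order sentence $\varphi$ in the language $\{S,S^{ -1}\}$ has limiting density equal to $1$ if $\mathbb{Z}\models\varphi$ and equal to $0$ otherwise.
   Context: The language has two unary function symbols $S,S^{ -1}$. The variety of bijective structures has axioms $(\forall x)\,SS^{ -1}(x)=x$ and $(\forall x)\,S^{ -1}S(x)=x$; let $T$ be the theory generated by these. $\mathbb{Z}$ denotes the bijective structure on the integers with $S(x)=x+1$, $S^{ -1}(x)=x-1$ (the free structure on one generator). A presentation consists of a generator $a$ and one identity of the form $t(a)=a$, where $t$ is an arbitrary (possibly empty, not necessarily reduced) finite string of the symbols $S,S^{ -1}$; the term $t(a)$ is called the relator. The resulting structure is the bijective structure generated by $a$ in which the equations between closed terms in $a$ that hold are exactly those that follow logically from $T$ and the identity. The length of the identity is the number of function symbols in $t$. Let $P_s$ be the number of presentations whose identity has length at most $s$ and $P_s(\varphi)$ the number of these whose resulting structure satisfies $\varphi$. The sentence $\varphi$ has limiting density $d$ if $\lim_{s\to\infty}P_s(\varphi)/P_s=d$. -}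

module Defs where

open import Level using (Level; 0ℓ; _⊔_; Lift) renaming (suc to lsuc)
open import Data.Nat.Base using (ℕ; suc; _≤_; NonZero)
open import Data.Integer.Base as ℤ using (ℤ; +_)
import Data.Integer.Properties as ℤ
open import Data.Rational.Base as ℚ using (ℚ; 0ℚ; _/_)
open import Data.Fin.Base using (Fin)
open import Data.List.Base using (List; foldr; length)
open import Data.List.Membership.Propositional using (_∈_)
open import Data.List.Relation.Unary.Unique.Propositional using (Unique)
open import Data.Product.Base using (_×_; ∃-syntax)
open import Data.Sum.Base using (_⊎_)
open import Data.Vec.Functional as Vector using (Vector)
open import Function.Bundles using (_⇔_)
open import Relation.Binary.Bundles using (Setoid)
open import Relation.Binary.PropositionalEquality using (_≡_; refl; cong; setoid)
open import Relation.Nullary.Negation using (¬_)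

private
  variable
    c ℓ : Level
    n : ℕ

data Symbol : Set where
  S S⁻¹ : Symbol

data Term (X : Set) : Set where
  var : X → Term X
  app : Symbol → Term X → Term X

infix  8 _≐_
infixr 7 _∧̇_
infixr 6 _∨̇_
infixr 5 _⇒̇_

-- Well-scoped de Bruijn formulas; index zero is the innermost bound variable.
data Formula (n : ℕ) : Set where
  _≐_            : Term (Fin n) → Term (Fin n) → Formula n
  ¬̇_             : Formula n → Formula n
  _∧̇_ _∨̇_ _⇒̇_ : Formula n → Formula n → Formula n
  ∀̇_ ∃̇_         : Formula (suc n) → Formula n

Sentence : Set
Sentence = Formula 0

-- Models of T. Equality is the setoid equality, so that quotients such as
-- the presented structures below can be formed.
record BijectiveStructure c ℓ : Set (lsuc (c ⊔ ℓ)) where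
  field
    domain : Setoid c ℓ
  open Setoid domain public
  field
    op      : Symbol → Carrier → Carrier
    op-cong : ∀ f {x y} → x ≈ y → op f x ≈ op f y
    SS⁻¹    : ∀ x → op S (op S⁻¹ x) ≈ x
    S⁻¹S    : ∀ x → op S⁻¹ (op S x) ≈ x

  eval : ∀ {X} → (X → Carrier) → Term X → Carrier
  eval ρ (var x)   = ρ x
  eval ρ (app f u) = op f (eval ρ u)

module _ (M : BijectiveStructure c ℓ) where
  open BijectiveStructure M

  Sat : Vector Carrier n → Formula n → Set (c ⊔ ℓ)
  Sat ρ (u ≐ v)  = Lift c (eval ρ u ≈ eval ρ v)
  Sat ρ (¬̇ φ)    = ¬ Sat ρ φ
  Sat ρ (φ ∧̇ ψ)  = Sat ρ φ × Sat ρ ψ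
  Sat ρ (φ ∨̇ ψ)  = Sat ρ φ ⊎ Sat ρ ψ
  Sat ρ (φ ⇒̇ ψ)  = Sat ρ φ → Sat ρ ψ
  Sat ρ (∀̇ φ)    = ∀ x → Sat (x Vector.∷ ρ) φ
  Sat ρ (∃̇ φ)    = ∃[ x ] Sat (x Vector.∷ ρ) φ

infix 4 _⊨_

_⊨_ : BijectiveStructure c ℓ → Sentence → Set (c ⊔ ℓ)
M ⊨ φ = Sat M Vector.[] φ

ℤ-structure : BijectiveStructure 0ℓ 0ℓ
ℤ-structure = record
  { domain  = setoid ℤ
  ; op      = λ { S → ℤ.suc ; S⁻¹ → ℤ.pred }
  ; op-cong = λ f → cong _
  ; SS⁻¹    = ℤ.suc-pred
  ; S⁻¹S    = ℤ.pred-suc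
  }

data Generator : Set where
  a : Generator

-- The string t stands for the identity t(a) = a.
Presentation : Set
Presentation = List Symbol

relator : Presentation → Term Generator
relator = foldr app (var a)

-- The equation u = v follows logically from T and the identity t(a) = a:
-- it holds in every model of T, under every interpretation of the constant a
-- that satisfies the identity.
infix 4 _⊩_≈_

_⊩_≈_ : Presentation → Term Generator → Term Generator → Set₁
t ⊩ u ≈ v = (M : BijectiveStructure 0ℓ 0ℓ) → let open BijectiveStructure M in
  (ρ : Generator → Carrier) →
  eval ρ (relator t) ≈ eval ρ (var a) → eval ρ u ≈ eval ρ v

presented : Presentation → BijectiveStructure 0ℓ (lsuc 0ℓ)
presented t = record
  { domain  = record
    { Carrier       = Term Generator
    ; _≈_           = t ⊩_≈_
    ; isEquivalence = record
      { refl  = λ M ρ r → BijectiveStructure.refl M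
      ; sym   = λ p M ρ r → BijectiveStructure.sym M (p M ρ r)
      ; trans = λ p q M ρ r → BijectiveStructure.trans M (p M ρ r) (q M ρ r)
      }
    }
  ; op      = app
  ; op-cong = λ f p M ρ r → BijectiveStructure.op-cong M f (p M ρ r)
  ; SS⁻¹    = λ u M ρ r → BijectiveStructure.SS⁻¹ M _
  ; S⁻¹S    = λ u M ρ r → BijectiveStructure.S⁻¹S M _
  }

-- Q has exactly n elements: they are listed without repetition.
HasCardinality : {A : Set} → (A → Set ℓ) → ℕ → Set ℓ
HasCardinality {A = A} Q n =
  ∃[ xs ] Unique xs × (∀ (x : A) → x ∈ xs ⇔ Q x) × length xs ≡ n

_⟶_ : (ℕ → ℚ) → ℚ → Set
f ⟶ d = ∀ ε → 0ℚ ℚ.< ε → ∃[ N ] ∀ s → N ≤ s → ℚ.∣ f s ℚ.- d ∣ ℚ.< ε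

-- P and Pφ are determined by the two counting fields, which also make
-- satisfaction of φ in the presented structures decidable. P-nonZero is
-- implied by P-counts (the empty string is always counted) and only serves
-- to form the quotient.
record HasLimitingDensity (φ : Sentence) (d : ℚ) : Set₁ where
  field
    P Pφ        : ℕ → ℕ
    P-counts    : ∀ s → HasCardinality (λ (t : Presentation) → length t ≤ s) (P s)
    Pφ-counts   : ∀ s → HasCardinality (λ t → length t ≤ s × presented t ⊨ φ) (Pφ s)
    {{P-nonZero}} : ∀ {s} → NonZero (P s)
    limit       : (λ s → + Pφ s / P s) ⟶ d

{-# OPTIONS --safe #-}
module Submission where

-- If t has k more letters S than S⁻¹, the structure presented by t(a) = a is ℤ/k. Quantifier
-- elimination for ℤ/k works uniformly in k as long as no nonzero integer of absolute value below a
-- threshold depending on φ is divisible by k, because ∃x is witnessed either by a solution of an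
-- atomic equation or by any element solving none of them. Hence ℤ/k and ℤ agree on φ once k = 0 or
-- |k| is large. The number of t of length n with a given k is zero or a binomial coefficient, so at
-- most 2ⁿ/√(n + 1), and the strings with |k| below the threshold have density zero.

open import Level using (Level; 0ℓ; _⊔_; lift; lower) renaming (suc to lsuc)
open import Data.Bool.Base using (Bool; true; false; not; _∧_; _∨_; T)
open import Data.Bool.Properties using (T-∧; T-∨; T?)
open import Data.Fin.Base as Fin using (Fin; toℕ)
import Data.Fin.Properties as Fin
open import Data.Integer.Base as ℤ using (ℤ; +_; -[1+_]; 0ℤ; 1ℤ; -1ℤ; ∣_∣)
open import Data.Integer.Divisibility.Signed as ℤ∣ using (_∣_; divides; _∣?_)
import Data.Integer.Properties as ℤ
import Data.Integer.Tactic.RingSolver as ℤSolver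
open import Data.List.Base using (List; []; _∷_; _++_; length; foldr; lookup; map; filter)
open import Data.List.Membership.Propositional using (_∈_)
open import Data.List.Membership.Propositional.Properties
  using (∈-map⁺; ∈-map⁻; ∈-++⁺ˡ; ∈-++⁺ʳ; ∈-++⁻; ∈-filter⁺; ∈-filter⁻)
import Data.List.Properties as List
open import Data.List.Relation.Binary.Disjoint.Propositional using (Disjoint)
open import Data.List.Relation.Unary.All as All using (All; []; _∷_)
import Data.List.Relation.Unary.All.Properties as All
open import Data.List.Relation.Unary.AllPairs using ([]; _∷_)
open import Data.List.Relation.Unary.Any as Any using (Any; here; there)
import Data.List.Relation.Unary.Any.Properties as Any
open import Data.List.Relation.Unary.Unique.Propositional using (Unique)
import Data.List.Relation.Unary.Unique.Propositional.Properties as Unique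
open import Data.Nat.Base as ℕ using (ℕ; zero; suc; z≤n; s≤s; NonZero)
import Data.Nat.Divisibility as ℕ∣
import Data.Nat.Properties as ℕ
import Data.Nat.Tactic.RingSolver as ℕSolver
open import Data.Product.Base as Product using (_×_; _,_; proj₁; proj₂; ∃-syntax)
open import Data.Rational.Base as ℚ using (ℚ; mkℚ; 0ℚ; 1ℚ; toℚᵘ)
import Data.Rational.Properties as ℚ
open import Data.Rational.Unnormalised.Base as ℚᵘ using (mkℚᵘ; *≡*; *<*)
import Data.Rational.Unnormalised.Properties as ℚᵘ
open import Data.Sum.Base as Sum using (_⊎_; inj₁; inj₂)
open import Data.Vec.Functional as Vector using (Vector)
open import Function.Base using (_∘_; id)
open import Function.Bundles using (_⇔_; mk⇔; Equivalence)
open import Function.Construct.Composition using (_⇔-∘_)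
open import Function.Construct.Symmetry using (⇔-sym)
open import Relation.Binary.PropositionalEquality
  using (_≡_; refl; sym; trans; cong; cong₂; subst; module ≡-Reasoning)
open import Relation.Nullary.Decidable as Dec
  using (Dec; yes; no; does; ¬?; _×-dec_; _⊎-dec_; _→-dec_; decidable-stable; dec-true; dec-false)
open import Relation.Nullary.Negation using (¬_; contradiction)
open import Relation.Unary using (Pred; Decidable)
open import Defs
open Equivalence using (to; from)

-- `HasLimitingDensity` asks for exact counts, so `presented t ⊨ φ` has to be decided for every t,
-- including the degrees below the threshold, where elimination may be wrong. For nonzero degree the
-- structure is finite and quantifiers are searched over residues; for degree 0 no finite search is
-- possible, and elimination itself decides. The elements of `presented t` are raw terms and its
-- equality is consequence in all models, so satisfaction is transported along relations between
-- setoids. Uniform elimination compares ℤ/k with ℤ because a sentence ends as a Boolean combination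
-- of constants, in which the modulus no longer occurs. The binomial estimate is kept in the squared
-- form C(n,k)² (n + 1) ≤ 4ⁿ, which stays in ℕ and suits induction. It says little about short
-- strings, yet P counts all lengths up to s; the short ones are absorbed by the growth of the
-- total.

private
  variable
    c ℓ c′ ℓ′ ℓ″ : Level
    A B : Set c

-- Invariance of satisfaction under bisimulation

module Structures where

  open import Data.Integer.Base using (_+_; _-_; -_; _*_)
  open import Data.Integer.DivMod using (_%_; _/_; a≡a%n+[a/n]*n; n%d<d)

  private
    variable
      n : ℕ

  -- Equality must be both preserved and reflected, because negation and implication reverse
  -- directions. A relation in place of a map covers all three uses: identity from ℤ to `ℤ/ 0ℤ`,
  -- congruence of a structure with itself, and degree from terms to integers.
  record Bisimulation (M : BijectiveStructure c ℓ) (N : BijectiveStructure c′ ℓ′) r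
         : Set (c ⊔ ℓ ⊔ c′ ⊔ ℓ′ ⊔ lsuc r) where
    private
      module M = BijectiveStructure M
      module N = BijectiveStructure N
    infix 4 _~_
    field
      _~_   : M.Carrier → N.Carrier → Set r
      forth : ∀ x → ∃[ y ] x ~ y
      back  : ∀ y → ∃[ x ] x ~ y
      op-~  : ∀ f {x y} → x ~ y → M.op f x ~ N.op f y
      ≈-~   : ∀ {x x′ y y′} → x ~ y → x′ ~ y′ → x M.≈ x′ ⇔ y N.≈ y′

    eval-~ : ∀ {X} {ρ σ} → (∀ x → ρ x ~ σ x) → (u : Term X) → M.eval ρ u ~ N.eval σ u
    eval-~ R (var x)   = R x
    eval-~ R (app f u) = op-~ f (eval-~ R u)

    ∷-~ : ∀ {ρ : Vector M.Carrier n} {σ x y} → x ~ y → (∀ i → ρ i ~ σ i) →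
          ∀ i → (x Vector.∷ ρ) i ~ (y Vector.∷ σ) i
    ∷-~ xy R Fin.zero    = xy
    ∷-~ xy R (Fin.suc i) = R i

    Sat-~ : (φ : Formula n) → ∀ {ρ σ} → (∀ i → ρ i ~ σ i) → Sat M ρ φ ⇔ Sat N σ φ
    Sat-~ (u ≐ v) R = mk⇔ (lift ∘ to E ∘ lower) (lift ∘ from E ∘ lower)
      where E = ≈-~ (eval-~ R u) (eval-~ R v)
    Sat-~ (¬̇ φ) R = mk⇔ (_∘ from E) (_∘ to E)
      where E = Sat-~ φ R
    Sat-~ (φ ∧̇ ψ) R = mk⇔ (Product.map (to E) (to F)) (Product.map (from E) (from F))
      where E = Sat-~ φ R ; F = Sat-~ ψ R
    Sat-~ (φ ∨̇ ψ) R = mk⇔ (Sum.map (to E) (to F)) (Sum.map (from E) (from F))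
      where E = Sat-~ φ R ; F = Sat-~ ψ R
    Sat-~ (φ ⇒̇ ψ) R = mk⇔ (λ h → to F ∘ h ∘ from E) (λ h → from F ∘ h ∘ to E)
      where E = Sat-~ φ R ; F = Sat-~ ψ R
    Sat-~ (∀̇ φ) R = mk⇔
      (λ h y → let (x , xy) = back y in to (Sat-~ φ (∷-~ xy R)) (h x))
      (λ h x → let (y , xy) = forth x in from (Sat-~ φ (∷-~ xy R)) (h y))
    Sat-~ (∃̇ φ) R = mk⇔
      (λ (x , h) → let (y , xy) = forth x in y , to (Sat-~ φ (∷-~ xy R)) h)
      (λ (y , h) → let (x , xy) = back y in x , from (Sat-~ φ (∷-~ xy R)) h)

    ⊨-~ : ∀ φ → M ⊨ φ ⇔ N ⊨ φ
    ⊨-~ φ = Sat-~ φ λ ()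

  -- The structures ℤ/d

  infix 5 ℤ/_

  shift : Symbol → ℤ → ℤ
  shift = BijectiveStructure.op ℤ-structure

  shift-+ : ∀ f x y → shift f (x + y) ≡ shift f x + y
  shift-+ S   x y = sym (ℤ.+-assoc 1ℤ x y)
  shift-+ S⁻¹ x y = sym (ℤ.+-assoc -1ℤ x y)

  shift-difference : ∀ f x y → shift f x - shift f y ≡ x - y
  shift-difference S   = lemma 1ℤ
    where
    lemma : ∀ e x y → (e + x) - (e + y) ≡ x - y
    lemma = ℤSolver.solve-∀
  shift-difference S⁻¹ = lemma -1ℤ
    where
    lemma : ∀ e x y → (e + x) - (e + y) ≡ x - y
    lemma = ℤSolver.solve-∀

  ≡⇒∣- : ∀ d {x y} → x ≡ y → d ∣ x - y
  ≡⇒∣- d {x} refl = divides 0ℤ (ℤ.+-inverseʳ x)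

  ∣-sym : ∀ {d} x y → d ∣ x - y → d ∣ y - x
  ∣-sym {d} x y h = subst (d ∣_) (lemma x y) (ℤ∣.∣m⇒∣-m h)
    where
    lemma : ∀ x y → - (x - y) ≡ y - x
    lemma = ℤSolver.solve-∀

  ∣-trans : ∀ {d} x y z → d ∣ x - y → d ∣ y - z → d ∣ x - z
  ∣-trans {d} x y z h k = subst (d ∣_) (lemma x y z) (ℤ∣.∣m∣n⇒∣m+n h k)
    where
    lemma : ∀ x y z → (x - y) + (y - z) ≡ x - z
    lemma = ℤSolver.solve-∀

  -- For d = 0 this is ℤ itself.
  ℤ/_ : ℤ → BijectiveStructure 0ℓ 0ℓ
  ℤ/ d = record
    { domain = record
      { Carrier       = ℤ
      ; _≈_           = λ x y → d ∣ x - y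
      ; isEquivalence = record
        { refl  = λ {x} → ≡⇒∣- d {x} refl
        ; sym   = λ {x y} → ∣-sym x y
        ; trans = λ {x y z} → ∣-trans x y z
        }
      }
    ; op      = shift
    ; op-cong = λ f {x y} → subst (d ∣_) (sym (shift-difference f x y))
    ; SS⁻¹    = λ x → ≡⇒∣- d (ℤ.suc-pred x)
    ; S⁻¹S    = λ x → ≡⇒∣- d (ℤ.pred-suc x)
    }

  ℤ-bisimulation : Bisimulation ℤ-structure (ℤ/ 0ℤ) 0ℓ
  ℤ-bisimulation = record
    { _~_   = _≡_
    ; forth = λ x → x , refl
    ; back  = λ x → x , refl
    ; op-~  = λ f → cong (shift f)
    ; ≈-~   = λ { {x} {x′} refl refl → mk⇔ (≡⇒∣- 0ℤ) (ℤ.i-j≡0⇒i≡j x x′ ∘ ℤ∣.0∣⇒≡0) }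
    }

  -- For `ℤ/ d` this allows congruent integers to be exchanged, inside an atom in `⟦substitute⟧` and
  -- inside a whole formula in `Sat-residue`.
  congruence-bisimulation : (M : BijectiveStructure c ℓ) → Bisimulation M M ℓ
  congruence-bisimulation M = record
    { _~_   = _≈_
    ; forth = λ x → x , ≈.refl
    ; back  = λ x → x , ≈.refl
    ; op-~  = op-cong
    ; ≈-~   = λ p q → mk⇔
        (λ h → ≈.trans (≈.sym p) (≈.trans h q))
        (λ h → ≈.trans p (≈.trans h (≈.sym q)))
    }
    where
    open BijectiveStructure M using (_≈_; op-cong)
    module ≈ = BijectiveStructure M

  -- Presented structures as quotients of ℤ

  degree : ∀ {X} → Term X → ℤ
  degree (var x)   = 0ℤ
  degree (app f u) = shift f (degree u)

  -- All symbols are unary, so a term contains exactly one variable; modulo T it is determined by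
  -- that variable and its degree.
  head : ∀ {X} → Term X → X
  head (var x)   = x
  head (app f u) = head u

  eval-ℤ/ : ∀ d {X} (ρ : X → ℤ) u → BijectiveStructure.eval (ℤ/ d) ρ u ≡ degree u + ρ (head u)
  eval-ℤ/ d ρ (var x)   = sym (ℤ.+-identityˡ _)
  eval-ℤ/ d ρ (app f u) = trans (cong (shift f) (eval-ℤ/ d ρ u)) (shift-+ f (degree u) _)

  power : ℤ → Term Generator
  power (+ zero)       = var a
  power (+ suc n)      = app S (power (+ n))
  power -[1+ zero ]    = app S⁻¹ (var a)
  power -[1+ suc n ]   = app S⁻¹ (power -[1+ n ])

  degree-power : ∀ z → degree (power z) ≡ z
  degree-power (+ zero)     = refl
  degree-power (+ suc n)    = cong ℤ.suc (degree-power (+ n))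
  degree-power -[1+ zero ]  = refl
  degree-power -[1+ suc n ] = cong ℤ.pred (degree-power -[1+ n ])

  module _ (M : BijectiveStructure c ℓ) (p : BijectiveStructure.Carrier M) where
    open BijectiveStructure M using (Carrier; domain; _≈_; op; op-cong; SS⁻¹; S⁻¹S; eval)
    private module ≈ = BijectiveStructure M
    open import Relation.Binary.Reasoning.Setoid domain

    orbit : ℤ → Carrier
    orbit z = eval (λ _ → p) (power z)

    op-orbit : ∀ f z → op f (orbit z) ≈ orbit (shift f z)
    op-orbit S   (+ n)          = ≈.refl
    op-orbit S   -[1+ zero ]    = SS⁻¹ _
    op-orbit S   -[1+ suc n ]   = SS⁻¹ _
    op-orbit S⁻¹ (+ zero)       = ≈.refl
    op-orbit S⁻¹ (+ suc n)      = S⁻¹S _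
    op-orbit S⁻¹ -[1+ n ]       = ≈.refl

    eval-orbit : ∀ {ρ} y → ρ a ≈ orbit y → ∀ u → eval ρ u ≈ orbit (degree u + y)
    eval-orbit y h (var a)   = ≈.trans h (≈.reflexive (cong orbit (sym (ℤ.+-identityˡ y))))
    eval-orbit y h (app f u) = ≈.trans (op-cong f (eval-orbit y h u)) (≈.trans
      (op-orbit f (degree u + y)) (≈.reflexive (cong orbit (shift-+ f (degree u) y))))

    -- Periods form a subgroup of ℤ. That is how the one relation t(a) = a, which says that `deg t`
    -- is a period, identifies all terms whose degrees differ by a multiple of `deg t`.
    Period : ℤ → Set ℓ
    Period w = p ≈ orbit w

    -- `orbit z` is by definition the value of `power z` at p, so `eval-orbit` applies to it with p
    -- read as `orbit w`.
    orbit-+-period : ∀ w → Period w → ∀ z → orbit (z + w) ≈ orbit z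
    orbit-+-period w h z = begin
      orbit (z + w)                   ≡⟨ cong (λ z → orbit (z + w)) (degree-power z) ⟨
      orbit (degree (power z) + w)    ≈⟨ eval-orbit w h (power z) ⟨
      orbit z                         ∎

    period-+ : ∀ v w → Period v → Period w → Period (v + w)
    period-+ v w h k = ≈.trans h (≈.sym (orbit-+-period w k v))

    period-neg : ∀ w → Period w → Period (- w)
    period-neg w h = begin
      p                ≡⟨ cong orbit (ℤ.+-inverseˡ w) ⟨
      orbit (- w + w)  ≈⟨ orbit-+-period w h (- w) ⟩
      orbit (- w)      ∎

    period-+* : ∀ w → Period w → ∀ n → Period (+ n * w)
    period-+* w h zero    = ≈.refl
    period-+* w h (suc n) =
      subst Period (sym (ℤ.suc-* (+ n) w)) (period-+ w (+ n * w) h (period-+* w h n))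

    period-* : ∀ w → Period w → ∀ q → Period (q * w)
    period-* w h (+ n)      = period-+* w h n
    period-* w h -[1+ n ] =
      subst Period (lemma (+ suc n) w) (period-+* (- w) (period-neg w h) (suc n))
      where
      lemma : ∀ q w → q * (- w) ≡ (- q) * w
      lemma = ℤSolver.solve-∀

    eval-cong-degree : ∀ {d} → Period d → ∀ {ρ} → ρ a ≈ p → ∀ u v →
                       d ∣ degree u - degree v → eval ρ u ≈ eval ρ v
    eval-cong-degree {d} P {ρ} h u v (divides q eq) = begin
      eval ρ u                      ≈⟨ eval-orbit 0ℤ h u ⟩
      orbit (degree u + 0ℤ)         ≡⟨ cong orbit (lemma (degree u) (degree v)) ⟩
      orbit (degree v + 0ℤ + (degree u - degree v))
                                    ≡⟨ cong (λ x → orbit (degree v + 0ℤ + x)) eq ⟩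
      orbit (degree v + 0ℤ + q * d) ≈⟨ orbit-+-period (q * d) (period-* d P q) (degree v + 0ℤ) ⟩
      orbit (degree v + 0ℤ)         ≈⟨ eval-orbit 0ℤ h v ⟨
      eval ρ v                      ∎
      where
      lemma : ∀ x y → x + 0ℤ ≡ (y + 0ℤ) + (x - y)
      lemma = ℤSolver.solve-∀

  deg : Presentation → ℤ
  deg t = degree (relator t)

  -- From left to right, the consequence is tested in the single model `ℤ/ deg t` with a interpreted
  -- as 0, where a term evaluates to its degree. From right to left, `deg t` is a period of a in any
  -- model of the relation.
  ⊩⇔∣ : ∀ t u v → t ⊩ u ≈ v ⇔ deg t ∣ degree u - degree v
  ⊩⇔∣ t u v = mk⇔ complete sound
    where
    d = deg t

    eval₀ : ∀ u → BijectiveStructure.eval (ℤ/ d) (λ _ → 0ℤ) u ≡ degree u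
    eval₀ u = trans (eval-ℤ/ d _ u) (ℤ.+-identityʳ _)

    complete : t ⊩ u ≈ v → d ∣ degree u - degree v
    complete h = subst (d ∣_) (cong₂ _-_ (eval₀ u) (eval₀ v)) (h (ℤ/ d) (λ _ → 0ℤ) relation)
      where
      relation : d ∣ BijectiveStructure.eval (ℤ/ d) (λ _ → 0ℤ) (relator t) - 0ℤ
      relation = subst (d ∣_) (sym (trans (ℤ.+-identityʳ _) (eval₀ (relator t)))) ℤ∣.∣-refl

    sound : d ∣ degree u - degree v → t ⊩ u ≈ v
    sound h M ρ r = eval-cong-degree M (ρ a) period ≈.refl u v h
      where
      module ≈ = BijectiveStructure M
      period : Period M (ρ a) d
      period = ≈.trans (≈.sym r) (≈.trans (eval-orbit M (ρ a) {ρ} 0ℤ ≈.refl (relator t))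
        (≈.reflexive (cong (orbit M (ρ a)) (ℤ.+-identityʳ d))))

  presented-bisimulation : ∀ t → Bisimulation (presented t) (ℤ/ deg t) 0ℓ
  presented-bisimulation t = record
    { _~_   = λ u z → degree u ≡ z
    ; forth = λ u → degree u , refl
    ; back  = λ z → power z , degree-power z
    ; op-~  = λ f → cong (shift f)
    ; ≈-~   = λ { {u} {v} refl refl → ⊩⇔∣ t u v }
    }

  -- Quantifier elimination, uniform in the modulus

  -- (i , m) denotes x_i + m.
  Offset : ℕ → Set
  Offset n = Fin n × ℤ

  value : Vector ℤ n → Offset n → ℤ
  value ρ (i , m) = m + ρ i

  infix  8 _≗_
  infixr 7 _and_
  infixr 6 _or_

  data QF (n : ℕ) : Set where
    _≗_      : Offset n → Offset n → QF n
    const    : Bool → QF n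
    neg      : QF n → QF n
    _and_ _or_ : QF n → QF n → QF n

  -- Boolean values make classical reasoning available, which justifies eliminating ∀ as ¬∃¬ and
  -- implication as a disjunction.
  ⟦_⟧ : QF n → ℤ → Vector ℤ n → Bool
  ⟦ σ ≗ τ ⟧ d ρ   = does (d ∣? value ρ σ - value ρ τ)
  ⟦ const b ⟧ d ρ = b
  ⟦ neg θ ⟧ d ρ   = not (⟦ θ ⟧ d ρ)
  ⟦ θ and η ⟧ d ρ = ⟦ θ ⟧ d ρ ∧ ⟦ η ⟧ d ρ
  ⟦ θ or η ⟧ d ρ  = ⟦ θ ⟧ d ρ ∨ ⟦ η ⟧ d ρ

  does-⇔ : ∀ {p q} {P : Set p} {Q : Set q} → P ⇔ Q → (P? : Dec P) (Q? : Dec Q) →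
           does P? ≡ does Q?
  does-⇔ P⇔Q (yes p) Q? = sym (dec-true Q? (to P⇔Q p))
  does-⇔ P⇔Q (no ¬p) Q? = sym (dec-false Q? (¬p ∘ from P⇔Q))

  T-does : ∀ {p} {P : Set p} (P? : Dec P) → T (does P?) ⇔ P
  T-does (yes p) = mk⇔ (λ _ → p) _
  T-does (no ¬p) = mk⇔ (λ ()) ¬p

  T-neg : ∀ b → T (not b) ⇔ (¬ T b)
  T-neg true  = mk⇔ (λ ()) (λ h → h _)
  T-neg false = mk⇔ (λ _ ()) _

  substituteₒ : Offset n → Offset (suc n) → Offset n
  substituteₒ (j , l) (Fin.zero  , m) = j , m + l
  substituteₒ τ       (Fin.suc i , m) = i , m

  substitute : Offset n → QF (suc n) → QF n
  substitute τ (σ ≗ σ′)  = substituteₒ τ σ ≗ substituteₒ τ σ′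
  substitute τ (const b) = const b
  substitute τ (neg θ)   = neg (substitute τ θ)
  substitute τ (θ and η) = substitute τ θ and substitute τ η
  substitute τ (θ or η)  = substitute τ θ or substitute τ η

  value-congruent : ∀ d (ρ : Vector ℤ n) τ {x} → d ∣ x - value ρ τ → ∀ σ →
    d ∣ value (x Vector.∷ ρ) σ - value ρ (substituteₒ τ σ)
  value-congruent d ρ (j , l) {x} h (Fin.zero , m) = subst (d ∣_) (lemma x (ρ j) m l) h
    where
    lemma : ∀ x y m l → x - (l + y) ≡ (m + x) - ((m + l) + y)
    lemma = ℤSolver.solve-∀
  value-congruent d ρ τ h (Fin.suc i , m) = ≡⇒∣- d {m + ρ i} refl

  -- Holds for every modulus: atoms see only congruence classes, so x need only be congruent to the
  -- substituted value.
  ⟦substitute⟧ : ∀ d (ρ : Vector ℤ n) τ {x} → d ∣ x - value ρ τ → ∀ θ →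
    ⟦ θ ⟧ d (x Vector.∷ ρ) ≡ ⟦ substitute τ θ ⟧ d ρ
  ⟦substitute⟧ d ρ τ {x} h (σ ≗ σ′) = does-⇔
    (Bisimulation.≈-~ (congruence-bisimulation (ℤ/ d))
      {v σ} {v σ′} (value-congruent d ρ τ h σ) (value-congruent d ρ τ h σ′))
    (d ∣? _) (d ∣? _)
    where v = value (x Vector.∷ ρ)
  ⟦substitute⟧ d ρ τ h (const b) = refl
  ⟦substitute⟧ d ρ τ h (neg θ)   = cong not (⟦substitute⟧ d ρ τ h θ)
  ⟦substitute⟧ d ρ τ h (θ and η) = cong₂ _∧_ (⟦substitute⟧ d ρ τ h θ) (⟦substitute⟧ d ρ τ h η)
  ⟦substitute⟧ d ρ τ h (θ or η)  = cong₂ _∨_ (⟦substitute⟧ d ρ τ h θ) (⟦substitute⟧ d ρ τ h η)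

  -- The values of x₀ that solve some atom of θ.
  poles : QF (suc n) → List (Offset n)
  poles ((Fin.zero  , m) ≗ (Fin.zero  , m′)) = []
  poles ((Fin.zero  , m) ≗ (Fin.suc j , m′)) = (j , m′ - m) ∷ []
  poles ((Fin.suc i , m) ≗ (Fin.zero  , m′)) = (i , m - m′) ∷ []
  poles ((Fin.suc i , m) ≗ (Fin.suc j , m′)) = []
  poles (const b) = []
  poles (neg θ)   = poles θ
  poles (θ and η) = poles θ ++ poles η
  poles (θ or η)  = poles θ ++ poles η

  -- θ for values of x₀ away from all poles.
  generic : QF (suc n) → QF n
  generic ((Fin.zero  , m) ≗ (Fin.zero  , m′)) = const (does (m ℤ.≟ m′))
  generic ((Fin.zero  , m) ≗ (Fin.suc j , m′)) = const false
  generic ((Fin.suc i , m) ≗ (Fin.zero  , m′)) = const false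
  generic ((Fin.suc i , m) ≗ (Fin.suc j , m′)) = (i , m) ≗ (j , m′)
  generic (const b) = const b
  generic (neg θ)   = neg (generic θ)
  generic (θ and η) = generic θ and generic η
  generic (θ or η)  = generic θ or generic η

  -- If d divides no nonzero integer below this bound, atoms x₀ + m ≗ x₀ + m′ just compare m with m′.
  spread : QF (suc n) → ℕ
  spread ((Fin.zero , m) ≗ (Fin.zero , m′)) = suc ∣ m - m′ ∣
  spread (_ ≗ _)   = 0
  spread (const b) = 0
  spread (neg θ)   = spread θ
  spread (θ and η) = spread θ ℕ.+ spread η
  spread (θ or η)  = spread θ ℕ.+ spread η

  -- Equivalent to d = 0 or N ≤ ∣ d ∣. In this form both cases share one proof, with e a difference
  -- that has to vanish.
  Sparse : ℕ → ℤ → Set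
  Sparse N d = ∀ {e} → ∣ e ∣ ℕ.< N → d ∣ e → e ≡ 0ℤ

  sparse-mono : ∀ {N N′ d} → N ℕ.≤ N′ → Sparse N′ d → Sparse N d
  sparse-mono N≤N′ s e<N = s (ℕ.<-≤-trans e<N N≤N′)

  sparse-+ˡ : ∀ {d} N N′ → Sparse (N ℕ.+ N′) d → Sparse N d
  sparse-+ˡ N N′ = sparse-mono (ℕ.m≤m+n N N′)

  sparse-+ʳ : ∀ {d} N N′ → Sparse (N ℕ.+ N′) d → Sparse N′ d
  sparse-+ʳ N N′ = sparse-mono (ℕ.m≤n+m N′ N)

  sparse-0 : ∀ N → Sparse N 0ℤ
  sparse-0 N _ = ℤ∣.0∣⇒≡0

  sparse-≤ : ∀ {N d} → N ℕ.≤ ∣ d ∣ → Sparse N d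
  sparse-≤ {N} {d} N≤d {+ zero}     e<N d∣e = refl
  sparse-≤ {N} {d} N≤d {+ suc e}    e<N d∣e =
    contradiction (ℕ.<-≤-trans e<N N≤d) (ℕ.≤⇒≯ (ℕ∣.∣⇒≤ (ℤ∣.∣⇒∣ᵤ d∣e)))
  sparse-≤ {N} {d} N≤d { -[1+ e ] } e<N d∣e =
    contradiction (ℕ.<-≤-trans e<N N≤d) (ℕ.≤⇒≯ (ℕ∣.∣⇒≤ (ℤ∣.∣⇒∣ᵤ d∣e)))

  Avoids : ℤ → Vector ℤ n → ℤ → List (Offset n) → Set
  Avoids d ρ x = All (λ τ → ¬ d ∣ x - value ρ τ)

  ⟦generic⟧ : ∀ d (ρ : Vector ℤ n) x θ → Sparse (spread θ) d → Avoids d ρ x (poles θ) →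
    ⟦ θ ⟧ d (x Vector.∷ ρ) ≡ ⟦ generic θ ⟧ d ρ
  ⟦generic⟧ d ρ x ((Fin.zero , m) ≗ (Fin.zero , m′)) s A = does-⇔
    (mk⇔ (λ h → ℤ.i-j≡0⇒i≡j m m′ (s ℕ.≤-refl (subst (d ∣_) (lemma m m′ x) h)))
         (λ eq → ≡⇒∣- d (cong (_+ x) eq)))
    (d ∣? _) (m ℤ.≟ m′)
    where
    lemma : ∀ m m′ x → (m + x) - (m′ + x) ≡ m - m′
    lemma = ℤSolver.solve-∀
  ⟦generic⟧ d ρ x ((Fin.zero , m) ≗ (Fin.suc j , m′)) s (A ∷ []) =
    dec-false (d ∣? _) (A ∘ subst (d ∣_) (lemma m m′ x (ρ j)))
    where
    lemma : ∀ m m′ x y → (m + x) - (m′ + y) ≡ x - ((m′ - m) + y)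
    lemma = ℤSolver.solve-∀
  ⟦generic⟧ d ρ x ((Fin.suc i , m) ≗ (Fin.zero , m′)) s (A ∷ []) =
    dec-false (d ∣? _) (A ∘ subst (d ∣_) (lemma m m′ x (ρ i)) ∘ ℤ∣.∣m⇒∣-m)
    where
    lemma : ∀ m m′ x y → - ((m + y) - (m′ + x)) ≡ x - ((m - m′) + y)
    lemma = ℤSolver.solve-∀
  ⟦generic⟧ d ρ x ((Fin.suc i , m) ≗ (Fin.suc j , m′)) s A = refl
  ⟦generic⟧ d ρ x (const b) s A = refl
  ⟦generic⟧ d ρ x (neg θ)   s A = cong not (⟦generic⟧ d ρ x θ s A)
  ⟦generic⟧ d ρ x (θ and η) s A = cong₂ _∧_
    (⟦generic⟧ d ρ x θ (sparse-+ˡ (spread θ) (spread η) s) (All.++⁻ˡ (poles θ) A))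
    (⟦generic⟧ d ρ x η (sparse-+ʳ (spread θ) (spread η) s) (All.++⁻ʳ (poles θ) A))
  ⟦generic⟧ d ρ x (θ or η)  s A = cong₂ _∨_
    (⟦generic⟧ d ρ x θ (sparse-+ˡ (spread θ) (spread η) s) (All.++⁻ˡ (poles θ) A))
    (⟦generic⟧ d ρ x η (sparse-+ʳ (spread θ) (spread η) s) (All.++⁻ʳ (poles θ) A))

  -- Among 0, …, |τs| two numbers would otherwise meet the same class.
  avoiding : ∀ d (ρ : Vector ℤ n) τs → Sparse (suc (length τs)) d → ∃[ x ] Avoids d ρ x τs
  avoiding d ρ τs s with Fin.any? {n = suc (length τs)} (λ i → ¬? (meets? i))
    where
    meets? : ∀ i → Dec (Any (λ τ → d ∣ + toℕ i - value ρ τ) τs)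
    meets? i = Any.any? (λ τ → d ∣? + toℕ i - value ρ τ) τs
  ... | yes (i , h) = + toℕ i , All.¬Any⇒All¬ τs h
  ... | no h = contradiction toℕi≡toℕj (ℕ.<⇒≢ i<j)
    where
    meets : ∀ (i : Fin (suc (length τs))) → Any (λ τ → d ∣ + toℕ i - value ρ τ) τs
    meets i = decidable-stable (Any.any? (λ τ → d ∣? + toℕ i - value ρ τ) τs) (λ ¬m → h (i , ¬m))
    clash = Fin.pigeonhole ℕ.≤-refl (Any.index ∘ meets)
    i = proj₁ clash
    j = proj₁ (proj₂ clash)
    i<j = proj₁ (proj₂ (proj₂ clash))
    v = value ρ (lookup τs (Any.index (meets i)))
    v≡ : v ≡ value ρ (lookup τs (Any.index (meets j)))
    v≡ = cong (value ρ ∘ lookup τs) (proj₂ (proj₂ (proj₂ clash)))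
    d∣i-j : d ∣ + toℕ i - + toℕ j
    d∣i-j = ∣-trans (+ toℕ i) v (+ toℕ j) (Any.lookup-index (meets i))
      (∣-sym (+ toℕ j) v (subst (λ v → d ∣ + toℕ j - v) (sym v≡) (Any.lookup-index (meets j))))
    ∣i-j∣< : ∣ + toℕ i - + toℕ j ∣ ℕ.< suc (length τs)
    ∣i-j∣< = ℕ.≤-<-trans
      (subst (λ z → ∣ z ∣ ℕ.≤ toℕ i ℕ.⊔ toℕ j) (sym (ℤ.[+m]-[+n]≡m⊖n (toℕ i) (toℕ j)))
        (ℤ.∣m⊝n∣≤m⊔n (toℕ i) (toℕ j)))
      (ℕ.⊔-lub (Fin.toℕ<n i) (Fin.toℕ<n j))
    toℕi≡toℕj : toℕ i ≡ toℕ j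
    toℕi≡toℕj = ℤ.+-injective (ℤ.i-j≡0⇒i≡j _ _ (s ∣i-j∣< d∣i-j))

  exists : QF (suc n) → QF n
  exists θ = foldr (λ τ → substitute τ θ or_) (generic θ) (poles θ)

  T-foldr-or : ∀ d (ρ : Vector ℤ n) (f : Offset n → QF n) θ τs →
    T (⟦ foldr (λ τ → f τ or_) θ τs ⟧ d ρ) ⇔ (Any (λ τ → T (⟦ f τ ⟧ d ρ)) τs ⊎ T (⟦ θ ⟧ d ρ))
  T-foldr-or d ρ f θ []       = mk⇔ inj₂ Sum.[ (λ ()) , id ]
  T-foldr-or d ρ f θ (τ ∷ τs) = mk⇔ sound complete
    where
    IH = T-foldr-or d ρ f θ τs

    sound : T (⟦ foldr (λ τ → f τ or_) θ (τ ∷ τs) ⟧ d ρ) →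
            Any (λ τ → T (⟦ f τ ⟧ d ρ)) (τ ∷ τs) ⊎ T (⟦ θ ⟧ d ρ)
    sound h with to (T-∨ {⟦ f τ ⟧ d ρ}) h
    ... | inj₁ h = inj₁ (here h)
    ... | inj₂ h = Sum.map₁ there (to IH h)

    complete : Any (λ τ → T (⟦ f τ ⟧ d ρ)) (τ ∷ τs) ⊎ T (⟦ θ ⟧ d ρ) →
               T (⟦ foldr (λ τ → f τ or_) θ (τ ∷ τs) ⟧ d ρ)
    complete (inj₁ (here h))  = from T-∨ (inj₁ h)
    complete (inj₁ (there h)) = from (T-∨ {⟦ f τ ⟧ d ρ}) (inj₂ (from IH (inj₁ h)))
    complete (inj₂ h)         = from (T-∨ {⟦ f τ ⟧ d ρ}) (inj₂ (from IH (inj₂ h)))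

  -- The first summand is what the pigeonhole argument of `avoiding` requires, the second what
  -- `⟦generic⟧` requires.
  existsBound : QF (suc n) → ℕ
  existsBound θ = suc (length (poles θ)) ℕ.+ spread θ

  T-exists : ∀ {d} (ρ : Vector ℤ n) θ → Sparse (existsBound θ) d →
    (∃[ x ] T (⟦ θ ⟧ d (x Vector.∷ ρ))) ⇔ T (⟦ exists θ ⟧ d ρ)
  T-exists {d = d} ρ θ s = mk⇔ sound complete
    where
    disjunction = T-foldr-or d ρ (λ τ → substitute τ θ) (generic θ) (poles θ)
    s₁ = sparse-+ˡ (suc (length (poles θ))) (spread θ) s
    s₂ = sparse-+ʳ (suc (length (poles θ))) (spread θ) s

    sound : (∃[ x ] T (⟦ θ ⟧ d (x Vector.∷ ρ))) → T (⟦ exists θ ⟧ d ρ)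
    sound (x , h) with Any.any? (λ τ → d ∣? x - value ρ τ) (poles θ)
    ... | yes meets = from disjunction (inj₁
            (Any.map (λ {τ} m → subst T (⟦substitute⟧ d ρ τ m θ) h) meets))
    ... | no ¬meets = from disjunction (inj₂
            (subst T (⟦generic⟧ d ρ x θ s₂ (All.¬Any⇒All¬ (poles θ) ¬meets)) h))

    complete : T (⟦ exists θ ⟧ d ρ) → ∃[ x ] T (⟦ θ ⟧ d (x Vector.∷ ρ))
    complete h with to disjunction h
    ... | inj₁ some = let (τ , h) = Any.satisfied some in
            value ρ τ , subst T (sym (⟦substitute⟧ d ρ τ (≡⇒∣- d {value ρ τ} refl) θ)) h
    ... | inj₂ h    = let (x , A) = avoiding d ρ (poles θ) s₁ in
            x , subst T (sym (⟦generic⟧ d ρ x θ s₂ A)) h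

  eliminate : Formula n → QF n
  eliminate (u ≐ v) = (head u , degree u) ≗ (head v , degree v)
  eliminate (¬̇ φ)   = neg (eliminate φ)
  eliminate (φ ∧̇ ψ) = eliminate φ and eliminate ψ
  eliminate (φ ∨̇ ψ) = eliminate φ or eliminate ψ
  eliminate (φ ⇒̇ ψ) = neg (eliminate φ) or eliminate ψ
  eliminate (∀̇ φ)   = neg (exists (neg (eliminate φ)))
  eliminate (∃̇ φ)   = exists (eliminate φ)

  -- Any common upper bound serves, as `Sparse` is antitone in its bound, hence sums in place of
  -- maxima. A quantifier contributes the bound of its already eliminated body, since it is the
  -- poles of that body which a witness has to avoid.
  threshold : Formula n → ℕ
  threshold (u ≐ v) = 0
  threshold (¬̇ φ)   = threshold φ
  threshold (φ ∧̇ ψ) = threshold φ ℕ.+ threshold ψ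
  threshold (φ ∨̇ ψ) = threshold φ ℕ.+ threshold ψ
  threshold (φ ⇒̇ ψ) = threshold φ ℕ.+ threshold ψ
  threshold (∀̇ φ)   = threshold φ ℕ.+ existsBound (neg (eliminate φ))
  threshold (∃̇ φ)   = threshold φ ℕ.+ existsBound (eliminate φ)

  Sat⇔eliminate : (φ : Formula n) → ∀ {d} → Sparse (threshold φ) d → ∀ ρ →
    Sat (ℤ/ d) ρ φ ⇔ T (⟦ eliminate φ ⟧ d ρ)
  Sat⇔eliminate (u ≐ v) {d} s ρ = mk⇔
    (λ (lift h) → from (T-does (d ∣? _)) (subst (d ∣_) eq h))
    (λ h → lift (subst (d ∣_) (sym eq) (to (T-does (d ∣? _)) h)))
    where eq = cong₂ _-_ (eval-ℤ/ d ρ u) (eval-ℤ/ d ρ v)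
  Sat⇔eliminate (¬̇ φ) s ρ = mk⇔
    (λ h → from (T-neg _) (h ∘ from E)) (λ h → to (T-neg _) h ∘ to E)
    where E = Sat⇔eliminate φ s ρ
  Sat⇔eliminate (φ ∧̇ ψ) s ρ = mk⇔
    (from T-∧ ∘ Product.map (to E) (to F)) (Product.map (from E) (from F) ∘ to T-∧)
    where
    E = Sat⇔eliminate φ (sparse-+ˡ (threshold φ) (threshold ψ) s) ρ
    F = Sat⇔eliminate ψ (sparse-+ʳ (threshold φ) (threshold ψ) s) ρ
  Sat⇔eliminate (φ ∨̇ ψ) s ρ = mk⇔
    (from T-∨ ∘ Sum.map (to E) (to F)) (Sum.map (from E) (from F) ∘ to T-∨)
    where
    E = Sat⇔eliminate φ (sparse-+ˡ (threshold φ) (threshold ψ) s) ρ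
    F = Sat⇔eliminate ψ (sparse-+ʳ (threshold φ) (threshold ψ) s) ρ
  Sat⇔eliminate (φ ⇒̇ ψ) {d} s ρ = mk⇔ sound complete
    where
    E = Sat⇔eliminate φ (sparse-+ˡ (threshold φ) (threshold ψ) s) ρ
    F = Sat⇔eliminate ψ (sparse-+ʳ (threshold φ) (threshold ψ) s) ρ

    sound : (Sat (ℤ/ d) ρ φ → Sat (ℤ/ d) ρ ψ) → T (⟦ eliminate (φ ⇒̇ ψ) ⟧ d ρ)
    sound h with T? (⟦ eliminate φ ⟧ d ρ)
    ... | yes p = from (T-∨ {not (⟦ eliminate φ ⟧ d ρ)}) (inj₂ (to F (h (from E p))))
    ... | no ¬p = from T-∨ (inj₁ (from (T-neg _) ¬p))

    complete : T (⟦ eliminate (φ ⇒̇ ψ) ⟧ d ρ) → Sat (ℤ/ d) ρ φ → Sat (ℤ/ d) ρ ψ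
    complete h p with to (T-∨ {not (⟦ eliminate φ ⟧ d ρ)}) h
    ... | inj₁ ¬p = contradiction (to E p) (to (T-neg _) ¬p)
    ... | inj₂ q  = from F q
  Sat⇔eliminate (∀̇ φ) {d} s ρ = mk⇔
    (λ h → from (T-neg _) λ e → let (x , ¬p) = from E e in to (T-neg _) ¬p (to (F x) (h x)))
    (λ h x → from (F x) (decidable-stable (T? _) λ ¬p →
      to (T-neg _) h (to E (x , from (T-neg _) ¬p))))
    where
    θ = neg (eliminate φ)
    E = T-exists ρ θ (sparse-+ʳ (threshold φ) (existsBound θ) s)
    F = λ x → Sat⇔eliminate φ (sparse-+ˡ (threshold φ) (existsBound θ) s) (x Vector.∷ ρ)
  Sat⇔eliminate (∃̇ φ) {d} s ρ = mk⇔
    (λ (x , h) → to E (x , to (F x) h))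
    (λ h → let (x , p) = from E h in x , from (F x) p)
    where
    θ = eliminate φ
    E = T-exists ρ θ (sparse-+ʳ (threshold φ) (existsBound θ) s)
    F = λ x → Sat⇔eliminate φ (sparse-+ˡ (threshold φ) (existsBound θ) s) (x Vector.∷ ρ)

  -- `Fin 0` is empty, so without variables there are no atoms, and only atoms depend on the
  -- modulus.
  ⟦sentence⟧ : ∀ (θ : QF 0) d d′ {ρ σ} → ⟦ θ ⟧ d ρ ≡ ⟦ θ ⟧ d′ σ
  ⟦sentence⟧ (const b) d d′ = refl
  ⟦sentence⟧ (neg θ)   d d′ = cong not (⟦sentence⟧ θ d d′)
  ⟦sentence⟧ (θ and η) d d′ = cong₂ _∧_ (⟦sentence⟧ θ d d′) (⟦sentence⟧ η d d′)
  ⟦sentence⟧ (θ or η)  d d′ = cong₂ _∨_ (⟦sentence⟧ θ d d′) (⟦sentence⟧ η d d′)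

  ℤ⇔ℤ/0 : ∀ φ → ℤ-structure ⊨ φ ⇔ ℤ/ 0ℤ ⊨ φ
  ℤ⇔ℤ/0 = Bisimulation.⊨-~ ℤ-bisimulation

  presented⇔ℤ/ : ∀ t φ → presented t ⊨ φ ⇔ ℤ/ deg t ⊨ φ
  presented⇔ℤ/ t = Bisimulation.⊨-~ (presented-bisimulation t)

  -- Both sides reduce to the same quantifier-free sentence, read at modulus `deg t` on one side and
  -- at modulus 0 on the other.
  presented⇔ℤ : ∀ φ t → threshold φ ℕ.≤ ∣ deg t ∣ → presented t ⊨ φ ⇔ ℤ-structure ⊨ φ
  presented⇔ℤ φ t large =
    ⇔-sym (ℤ⇔ℤ/0 φ) ⇔-∘ (⇔-sym (Sat⇔eliminate φ (sparse-0 _) _) ⇔-∘ (sentence ⇔-∘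
      (Sat⇔eliminate φ (sparse-≤ large) _ ⇔-∘ presented⇔ℤ/ t φ)))
    where
    sentence : T (⟦ eliminate φ ⟧ (deg t) _) ⇔ T (⟦ eliminate φ ⟧ 0ℤ _)
    sentence = mk⇔ (subst T eq) (subst T (sym eq))
      where eq = ⟦sentence⟧ (eliminate φ) (deg t) 0ℤ

  -- Deciding satisfaction for every modulus

  module _ (d : ℤ) .{{_ : ℤ.NonZero d}} where

    residue : ℤ → Fin ∣ d ∣
    residue x = Fin.fromℕ< (n%d<d x d)

    residue-correct : ∀ x → d ∣ x - + toℕ (residue x)
    residue-correct x = divides (x / d) (begin
      x - + toℕ (residue x)           ≡⟨ cong (λ r → x - + r) (Fin.toℕ-fromℕ< (n%d<d x d)) ⟩
      x - + r                         ≡⟨ cong (_- + r) (a≡a%n+[a/n]*n x d) ⟩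
      (+ r + (x / d) * d) - + r       ≡⟨ lemma (+ r) ((x / d) * d) ⟩
      (x / d) * d                     ∎)
      where
      open ≡-Reasoning
      r = x % d
      lemma : ∀ r y → (r + y) - r ≡ y
      lemma = ℤSolver.solve-∀

    Sat-residue : ∀ (φ : Formula (suc n)) ρ x →
      Sat (ℤ/ d) (x Vector.∷ ρ) φ ⇔ Sat (ℤ/ d) (+ toℕ (residue x) Vector.∷ ρ) φ
    Sat-residue φ ρ x = Sat-~ φ (∷-~ {ρ = ρ} (residue-correct x) (λ i → ≡⇒∣- d {ρ i} refl))
      where open Bisimulation (congruence-bisimulation (ℤ/ d))

    sat? : ∀ (φ : Formula n) ρ → Dec (Sat (ℤ/ d) ρ φ)
    sat? (u ≐ v) ρ = Dec.map′ lift lower (d ∣? _)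
    sat? (¬̇ φ)   ρ = ¬? (sat? φ ρ)
    sat? (φ ∧̇ ψ) ρ = sat? φ ρ ×-dec sat? ψ ρ
    sat? (φ ∨̇ ψ) ρ = sat? φ ρ ⊎-dec sat? ψ ρ
    sat? (φ ⇒̇ ψ) ρ = sat? φ ρ →-dec sat? ψ ρ
    sat? (∀̇ φ)   ρ = Dec.map′
      (λ h x → from (Sat-residue φ ρ x) (h (residue x)))
      (λ h i → h (+ toℕ i))
      (Fin.all? λ i → sat? φ (+ toℕ i Vector.∷ ρ))
    sat? (∃̇ φ)   ρ = Dec.map′
      (λ (i , h) → + toℕ i , h)
      (λ (x , h) → residue x , to (Sat-residue φ ρ x) h)
      (Fin.any? λ i → sat? φ (+ toℕ i Vector.∷ ρ))

  -- Residues give no finite search here, but modulus 0 is sparse for every bound, so the eliminated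
  -- sentence is always correct.
  ℤ/0⊨? : ∀ φ → Dec (ℤ/ 0ℤ ⊨ φ)
  ℤ/0⊨? φ = Dec.map (⇔-sym (Sat⇔eliminate φ (sparse-0 _) _)) (T? _)

  ℤ/⊨? : ∀ d φ → Dec (ℤ/ d ⊨ φ)
  ℤ/⊨? (+ zero)     φ = ℤ/0⊨? φ
  ℤ/⊨? d@(+ suc _)  φ = sat? d φ _
  ℤ/⊨? d@(-[1+ _ ]) φ = sat? d φ _

  ℤ⊨? : ∀ φ → Dec (ℤ-structure ⊨ φ)
  ℤ⊨? φ = Dec.map (⇔-sym (ℤ⇔ℤ/0 φ)) (ℤ/0⊨? φ)

  presented⊨? : ∀ φ t → Dec (presented t ⊨ φ)
  presented⊨? φ t = Dec.map (⇔-sym (presented⇔ℤ/ t φ)) (ℤ/⊨? (deg t) φ)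

open Structures using (deg; threshold; presented⇔ℤ; presented⊨?; ℤ⊨?)

-- Counting by filtering lists

module Counting where

  open import Data.Nat.Base using (_+_; _*_; _^_; _≤_; _<_; _!)
  open import Data.Nat.Combinatorics using (_C_; nCk+nC[k+1]≡[n+1]C[k+1]; k![n∸k]!∣n!)
  open import Data.Nat.Combinatorics.Specification using (nCk≡n!/k![n-k]!; k>n⇒nCk≡0)
  open import Data.Nat.DivMod using (_/_; m/n*n≡m; m*n/n≡m)

  count : {P : Pred A ℓ} → Decidable P → List A → ℕ
  count P? xs = length (filter P? xs)

  count-++ : {P : Pred A ℓ} (P? : Decidable P) → ∀ xs ys →
    count P? (xs ++ ys) ≡ count P? xs + count P? ys
  count-++ P? xs ys = trans (cong length (List.filter-++ P? xs ys)) (List.length-++ (filter P? xs))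

  count-map : {P : Pred B ℓ} (P? : Decidable P) (f : A → B) → ∀ xs →
    count P? (map f xs) ≡ count (P? ∘ f) xs
  count-map P? f []       = refl
  count-map P? f (x ∷ xs) with does (P? (f x))
  ... | true  = cong suc (count-map P? f xs)
  ... | false = count-map P? f xs

  count-none : {P : Pred A ℓ} (P? : Decidable P) → (∀ x → ¬ P x) → ∀ xs → count P? xs ≡ 0
  count-none P? h xs = cong length (List.filter-none P? {xs} (All.universal h xs))

  count-mono : {P : Pred A ℓ} {Q : Pred A ℓ′} (P? : Decidable P) (Q? : Decidable Q) → ∀ xs →
    (∀ {x} → x ∈ xs → P x → Q x) → count P? xs ≤ count Q? xs
  count-mono P? Q? []       h = z≤n
  count-mono P? Q? (x ∷ xs) h with P? x | Q? x
  ... | yes p | yes q = s≤s (count-mono P? Q? xs (h ∘ there))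
  ... | yes p | no ¬q = contradiction (h (here refl) p) ¬q
  ... | no ¬p | yes q = ℕ.m≤n⇒m≤1+n (count-mono P? Q? xs (h ∘ there))
  ... | no ¬p | no ¬q = count-mono P? Q? xs (h ∘ there)

  count-cong : {P : Pred A ℓ} {Q : Pred A ℓ′} (P? : Decidable P) (Q? : Decidable Q) → ∀ xs →
    (∀ x → P x ⇔ Q x) → count P? xs ≡ count Q? xs
  count-cong P? Q? xs h = ℕ.≤-antisym
    (count-mono P? Q? xs λ _ → to (h _))
    (count-mono Q? P? xs λ _ → from (h _))

  count-⊎ : {P : Pred A ℓ} {Q : Pred A ℓ′} {R : Pred A ℓ″}
    (P? : Decidable P) (Q? : Decidable Q) (R? : Decidable R) → ∀ xs →
    (∀ x → P x → Q x ⊎ R x) → count P? xs ≤ count Q? xs + count R? xs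
  count-⊎ P? Q? R? []       h = z≤n
  count-⊎ P? Q? R? (x ∷ xs) h with P? x | Q? x | R? x | count-⊎ P? Q? R? xs h
  ... | yes p | yes q | yes r | IH = s≤s (ℕ.≤-trans IH (ℕ.+-monoʳ-≤ _ (ℕ.n≤1+n _)))
  ... | yes p | yes q | no ¬r | IH = s≤s IH
  ... | yes p | no ¬q | yes r | IH = ℕ.≤-trans (s≤s IH) (ℕ.≤-reflexive (sym (ℕ.+-suc _ _)))
  ... | yes p | no ¬q | no ¬r | IH = contradiction (h x p) Sum.[ ¬q , ¬r ]
  ... | no ¬p | yes q | yes r | IH = ℕ.m≤n⇒m≤1+n (ℕ.≤-trans IH (ℕ.+-monoʳ-≤ _ (ℕ.n≤1+n _)))
  ... | no ¬p | yes q | no ¬r | IH = ℕ.m≤n⇒m≤1+n IH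
  ... | no ¬p | no ¬q | yes r | IH = ℕ.≤-trans IH (ℕ.+-monoʳ-≤ _ (ℕ.n≤1+n _))
  ... | no ¬p | no ¬q | no ¬r | IH = IH

  count-complement : {P : Pred A ℓ} (P? : Decidable P) → ∀ xs →
    count P? xs + count (¬? ∘ P?) xs ≡ length xs
  count-complement P? []       = refl
  count-complement P? (x ∷ xs) with does (P? x)
  ... | true  = cong suc (count-complement P? xs)
  ... | false = trans (ℕ.+-suc _ _) (cong suc (count-complement P? xs))

  -- Enumeration of the presentations

  words : ℕ → List Presentation
  words zero    = [] ∷ []
  words (suc n) = map (S ∷_) (words n) ++ map (S⁻¹ ∷_) (words n)

  words≤ : ℕ → List Presentation
  words≤ zero    = words zero
  words≤ (suc s) = words (suc s) ++ words≤ s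

  length-∈-words : ∀ n {t} → t ∈ words n → length t ≡ n
  length-∈-words zero    (here refl) = refl
  length-∈-words (suc n) h with ∈-++⁻ (map (S ∷_) (words n)) h
  ... | inj₁ h with (t , t∈ , refl) ← ∈-map⁻ (S ∷_) h   = cong suc (length-∈-words n t∈)
  ... | inj₂ h with (t , t∈ , refl) ← ∈-map⁻ (S⁻¹ ∷_) h = cong suc (length-∈-words n t∈)

  ∈-words : ∀ t → t ∈ words (length t)
  ∈-words []        = here refl
  ∈-words (S ∷ t)   = ∈-++⁺ˡ (∈-map⁺ (S ∷_) (∈-words t))
  ∈-words (S⁻¹ ∷ t) = ∈-++⁺ʳ (map (S ∷_) (words (length t))) (∈-map⁺ (S⁻¹ ∷_) (∈-words t))

  words-unique : ∀ n → Unique (words n)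
  words-unique zero    = [] ∷ []
  words-unique (suc n) = Unique.++⁺
    (Unique.map⁺ List.∷-injectiveʳ (words-unique n))
    (Unique.map⁺ List.∷-injectiveʳ (words-unique n))
    disjoint
    where
    disjoint : Disjoint (map (S ∷_) (words n)) (map (S⁻¹ ∷_) (words n))
    disjoint (h , k) with ∈-map⁻ (S ∷_) h | ∈-map⁻ (S⁻¹ ∷_) k
    ... | _ , _ , refl | _ , _ , ()

  length-∈-words≤ : ∀ s {t} → t ∈ words≤ s → length t ≤ s
  length-∈-words≤ zero    h = ℕ.≤-reflexive (length-∈-words zero h)
  length-∈-words≤ (suc s) h with ∈-++⁻ (words (suc s)) h
  ... | inj₁ h = ℕ.≤-reflexive (length-∈-words (suc s) h)
  ... | inj₂ h = ℕ.m≤n⇒m≤1+n (length-∈-words≤ s h)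

  ∈-words≤ : ∀ s {t} → length t ≤ s → t ∈ words≤ s
  ∈-words≤ zero    {[]} h = here refl
  ∈-words≤ (suc s) {t}  h with ℕ.m≤n⇒m<n∨m≡n h
  ... | inj₁ t<1+s = ∈-++⁺ʳ (words (suc s)) (∈-words≤ s (ℕ.s≤s⁻¹ t<1+s))
  ... | inj₂ t≡1+s = ∈-++⁺ˡ (subst (λ n → t ∈ words n) t≡1+s (∈-words t))

  words≤-unique : ∀ s → Unique (words≤ s)
  words≤-unique zero    = words-unique zero
  words≤-unique (suc s) = Unique.++⁺ (words-unique (suc s)) (words≤-unique s)
    λ (h , k) → ℕ.1+n≰n (subst (_≤ s) (length-∈-words (suc s) h) (length-∈-words≤ s k))

  length-words : ∀ n → length (words n) ≡ 2 ^ n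
  length-words zero    = refl
  length-words (suc n) = begin
    length (map (S ∷_) ws ++ map (S⁻¹ ∷_) ws)
      ≡⟨ List.length-++ (map (S ∷_) ws) ⟩
    length (map (S ∷_) ws) + length (map (S⁻¹ ∷_) ws)
      ≡⟨ cong₂ _+_ (List.length-map _ ws) (List.length-map _ ws) ⟩
    length ws + length ws
      ≡⟨ cong (λ k → k + k) (length-words n) ⟩
    2 ^ n + 2 ^ n
      ≡⟨ cong (λ k → 2 ^ n + k) (ℕ.+-identityʳ (2 ^ n)) ⟨
    2 ^ suc n ∎
    where
    open ≡-Reasoning
    ws = words n

  n<2^n : ∀ n → n < 2 ^ n
  n<2^n zero    = s≤s z≤n
  n<2^n (suc n) = ℕ.≤-trans (s≤s (n<2^n n))
    (ℕ.+-mono-≤ (ℕ.m^n>0 2 n) (ℕ.≤-reflexive (sym (ℕ.+-identityʳ (2 ^ n)))))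

  size : ℕ → ℕ
  size s = length (words≤ s)

  size-suc : ∀ s → size (suc s) ≡ 2 ^ suc s + size s
  size-suc s = trans (List.length-++ (words (suc s))) (cong (_+ size s) (length-words (suc s)))

  -- A crude growth rate, enough for `size s` to exceed any constant in `small-negligible`.
  size> : ∀ s → s < size s
  size> zero    = s≤s z≤n
  size> (suc s) = ℕ.<-≤-trans (n<2^n (suc s))
    (ℕ.≤-trans (ℕ.m≤m+n _ (size s)) (ℕ.≤-reflexive (sym (size-suc s))))

  -- Distribution of the degree

  ups : Presentation → ℕ
  ups []        = 0
  ups (S ∷ t)   = suc (ups t)
  ups (S⁻¹ ∷ t) = ups t

  count-ups : ∀ n k → count (λ t → ups t ℕ.≟ k) (words n) ≡ n C k
  count-ups zero    zero    = refl
  count-ups zero    (suc k) = refl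
  count-ups (suc n) k = begin
    count (ups≟ k) (map (S ∷_) ws ++ map (S⁻¹ ∷_) ws)
      ≡⟨ count-++ (ups≟ k) (map (S ∷_) ws) _ ⟩
    count (ups≟ k) (map (S ∷_) ws) + count (ups≟ k) (map (S⁻¹ ∷_) ws)
      ≡⟨ cong₂ _+_ (count-map (ups≟ k) (S ∷_) ws) (count-map (ups≟ k) (S⁻¹ ∷_) ws) ⟩
    count (1+ups≟ k) ws + count (ups≟ k) ws
      ≡⟨ pascal k ⟩
    suc n C k ∎
    where
    open ≡-Reasoning
    ws = words n
    ups≟ : ∀ k t → Dec (ups t ≡ k)
    ups≟ k t = ups t ℕ.≟ k
    1+ups≟ : ∀ k t → Dec (suc (ups t) ≡ k)
    1+ups≟ k t = suc (ups t) ℕ.≟ k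
    pascal : ∀ k → count (1+ups≟ k) ws + count (ups≟ k) ws ≡ suc n C k
    pascal zero    = cong₂ _+_ (count-none (1+ups≟ 0) (λ _ ()) ws) (count-ups n 0)
    pascal (suc k) = begin
      count (1+ups≟ (suc k)) ws + count (ups≟ (suc k)) ws
        ≡⟨ cong (_+ count (ups≟ (suc k)) ws) (count-cong (1+ups≟ (suc k)) (ups≟ k) ws
             (λ _ → mk⇔ ℕ.suc-injective (cong suc))) ⟩
      count (ups≟ k) ws + count (ups≟ (suc k)) ws
        ≡⟨ cong₂ _+_ (count-ups n k) (count-ups n (suc k)) ⟩
      n C k + n C suc k
        ≡⟨ nCk+nC[k+1]≡[n+1]C[k+1] n k ⟩
      suc n C suc k ∎

  -- The degree is the number of S minus the number of S⁻¹ and the length is their sum; adding the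
  -- two cancels S⁻¹.
  deg-ups : ∀ t → deg t ℤ.+ + length t ≡ + (ups t * 2)
  deg-ups []        = refl
  deg-ups (S ∷ t)   = trans (lemma 1ℤ (deg t) (+ length t)) (cong (λ z → + 2 ℤ.+ z) (deg-ups t))
    where
    lemma : ∀ e d n → (e ℤ.+ d) ℤ.+ (e ℤ.+ n) ≡ (e ℤ.+ e) ℤ.+ (d ℤ.+ n)
    lemma = ℤSolver.solve-∀
  deg-ups (S⁻¹ ∷ t) = trans (lemma 1ℤ (deg t) (+ length t)) (deg-ups t)
    where
    lemma : ∀ e d n → (ℤ.- e ℤ.+ d) ℤ.+ (e ℤ.+ n) ≡ d ℤ.+ n
    lemma = ℤSolver.solve-∀

  -- At fixed length the degree determines the number of S. If d has the wrong parity the quotient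
  -- is meaningless, but then no string has degree d; hence `count-degree` draws only an inequality
  -- from this.
  ups-deg : ∀ {n d t} → length t ≡ n → deg t ≡ d → ups t ≡ ∣ d ℤ.+ + n ∣ / 2
  ups-deg {t = t} refl refl = sym (trans (cong (λ z → ∣ z ∣ / 2) (deg-ups t)) (m*n/n≡m (ups t) 2))

  -- Binomial coefficients are small compared to powers of two

  -- Indexing by the two parts of n makes the symmetry and the induction steps expressible without
  -- truncated subtraction.
  binomial : ℕ → ℕ → ℕ
  binomial p q = (p + q) C p

  binomial-! : ∀ p q → binomial p q * (p ! * q !) ≡ (p + q) !
  binomial-! p q = begin
    b * (p ! * q !)                  ≡⟨ cong (λ r → b * (p ! * r !)) (ℕ.m+n∸m≡n p q) ⟨
    b * (p ! * (p + q ℕ.∸ p) !)      ≡⟨ cong (_* (p ! * (p + q ℕ.∸ p) !)) (nCk≡n!/k![n-k]! p≤p+q) ⟩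
    _                                ≡⟨ m/n*n≡m {{p ℕ.!* (p + q ℕ.∸ p) !≢0}} (k![n∸k]!∣n! p≤p+q) ⟩
    (p + q) !                        ∎
    where
    open ≡-Reasoning
    b = binomial p q
    p≤p+q = ℕ.m≤m+n p q

  binomial-comm : ∀ p q → binomial p q ≡ binomial q p
  binomial-comm p q = ℕ.*-cancelʳ-≡ _ _ (p ! * q !) {{p ℕ.!* q !≢0}} (begin
    binomial p q * (p ! * q !)   ≡⟨ binomial-! p q ⟩
    (p + q) !                    ≡⟨ cong _! (ℕ.+-comm p q) ⟩
    (q + p) !                    ≡⟨ binomial-! q p ⟨
    binomial q p * (q ! * p !)   ≡⟨ cong (binomial q p *_) (ℕ.*-comm (q !) (p !)) ⟩
    binomial q p * (p ! * q !)   ∎)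
    where open ≡-Reasoning

  binomial-suc : ∀ p q → suc p * binomial (suc p) q ≡ suc (p + q) * binomial p q
  binomial-suc p q = ℕ.*-cancelʳ-≡ _ _ (p ! * q !) {{p ℕ.!* q !≢0}} (begin
    suc p * binomial (suc p) q * (p ! * q !)     ≡⟨ lemma (suc p) (binomial (suc p) q) (p !) (q !) ⟩
    binomial (suc p) q * (suc p ! * q !)         ≡⟨ binomial-! (suc p) q ⟩
    suc (p + q) * (p + q) !                      ≡⟨ cong (suc (p + q) *_) (binomial-! p q) ⟨
    suc (p + q) * (binomial p q * (p ! * q !))   ≡⟨ ℕ.*-assoc (suc (p + q)) (binomial p q) _ ⟨
    suc (p + q) * binomial p q * (p ! * q !)     ∎)
    where
    open ≡-Reasoning
    lemma : ∀ s b x y → s * b * (x * y) ≡ b * (s * x * y)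
    lemma = ℕSolver.solve-∀

  -- Two applications of `binomial-suc`, with symmetry in between to change the side that grows.
  binomial-diagonal : ∀ p → suc p * binomial (suc p) (suc p) ≡ 2 * suc (p + p) * binomial p p
  binomial-diagonal p = ℕ.*-cancelˡ-≡ _ _ (suc p) (begin
    suc p * (suc p * binomial (suc p) (suc p))       ≡⟨ cong (suc p *_) (binomial-suc p (suc p)) ⟩
    suc p * (m * binomial p (suc p))                 ≡⟨ cong (λ b → suc p * (m * b)) (binomial-comm p (suc p)) ⟩
    suc p * (m * binomial (suc p) p)                 ≡⟨ lemma₁ (suc p) m (binomial (suc p) p) ⟩
    m * (suc p * binomial (suc p) p)                 ≡⟨ cong (m *_) (binomial-suc p p) ⟩
    m * (suc (p + p) * binomial p p)                 ≡⟨ lemma₂ p (binomial p p) ⟩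
    suc p * (2 * suc (p + p) * binomial p p)         ∎)
    where
    open ≡-Reasoning
    m = suc (p + suc p)
    lemma₁ : ∀ x y z → x * (y * z) ≡ y * (x * z)
    lemma₁ = ℕSolver.solve-∀
    lemma₂ : ∀ p b → suc (p + suc p) * (suc (p + p) * b) ≡ suc p * (2 * suc (p + p) * b)
    lemma₂ = ℕSolver.solve-∀

  -- With n = p + q, the bound is proved along the diagonal first, by steps (p , p) ↦ (p + 1 , p + 1).
  -- It is preserved by steps (p , q) ↦ (p + 1 , q) with q ≤ p since (n + 1) (n + 2) ≤ (2 (p + 1))².
  CentralBound : ℕ → ℕ → Set
  CentralBound p q = binomial p q * binomial p q * suc (p + q) ≤ 4 ^ (p + q)

  -- One induction step with denominators cleared: b′ / b = e / s, the factor n + 1 grows from x to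
  -- e′, and the power of 4 is multiplied by k.
  scale-bound : ∀ s x k b b′ e e′ {m} .{{_ : NonZero s}} .{{_ : NonZero x}} →
    s * b′ ≡ e * b → b * b * x ≤ m → e * e * e′ ≤ s * s * k * x →
    b′ * b′ * e′ ≤ k * m
  scale-bound s x k b b′ e e′ {m} eq bound h =
    ℕ.*-cancelˡ-≤ (s * s * x) {{ℕ.m*n≢0 (s * s) x {{ℕ.m*n≢0 s s}}}} (begin
      s * s * x * (b′ * b′ * e′)     ≡⟨ lemma₁ s x b′ e′ ⟩
      s * b′ * (s * b′) * (e′ * x)   ≡⟨ cong (λ z → z * z * (e′ * x)) eq ⟩
      e * b * (e * b) * (e′ * x)     ≡⟨ lemma₂ e b e′ x ⟩
      e * e * e′ * (b * b * x)       ≤⟨ ℕ.*-mono-≤ h bound ⟩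
      s * s * k * x * m              ≡⟨ lemma₃ s k x m ⟩
      s * s * x * (k * m)            ∎)
    where
    open ℕ.≤-Reasoning
    lemma₁ : ∀ s x b e → s * s * x * (b * b * e) ≡ s * b * (s * b) * (e * x)
    lemma₁ = ℕSolver.solve-∀
    lemma₂ : ∀ e b e′ x → e * b * (e * b) * (e′ * x) ≡ e * e * e′ * (b * b * x)
    lemma₂ = ℕSolver.solve-∀
    lemma₃ : ∀ s k x m → s * s * k * x * m ≡ s * s * x * (k * m)
    lemma₃ = ℕSolver.solve-∀

  centralBound-suc : ∀ p q → q ≤ p → CentralBound p q → CentralBound (suc p) q
  centralBound-suc p q q≤p h = scale-bound
    (suc p) n 4 (binomial p q) (binomial (suc p) q) n (suc n) (binomial-suc p q) h
    (begin
      n * n * suc n                            ≡⟨ ℕ.*-assoc n n (suc n) ⟩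
      n * (n * suc n)                          ≤⟨ ℕ.*-monoʳ-≤ n (ℕ.*-mono-≤ (ℕ.<⇒≤ 1+n≤) 1+n≤) ⟩
      n * ((suc p + suc p) * (suc p + suc p))  ≡⟨ lemma n (suc p) ⟩
      suc p * suc p * 4 * n                    ∎)
    where
    open ℕ.≤-Reasoning
    n = suc (p + q)
    1+n≤ : suc n ≤ suc p + suc p
    1+n≤ = ℕ.≤-trans (s≤s (s≤s (ℕ.+-monoʳ-≤ p q≤p))) (ℕ.≤-reflexive (cong suc (sym (ℕ.+-suc p p))))
    lemma : ∀ n s → n * ((s + s) * (s + s)) ≡ s * s * 4 * n
    lemma = ℕSolver.solve-∀

  -- A second single step, from (p , p + 1) to (p + 1 , p + 1), would need the false (2p + 2)(2p +
  -- 3) ≤ (2p + 2)². The double step needs only (2p + 1)(2p + 3) ≤ (2p + 2)², where the sides differ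
  -- by one.
  centralBound-diagonal : ∀ p → CentralBound p p
  centralBound-diagonal zero    = ℕ.≤-refl
  centralBound-diagonal (suc p) = subst (b * b * suc (suc p + suc p) ≤_) (sym pow) (scale-bound
    (suc p) n 16 (binomial p p) b (2 * n) (suc (suc p + suc p))
    (binomial-diagonal p) (centralBound-diagonal p)
    (begin
      2 * n * (2 * n) * suc (suc p + suc p)             ≡⟨ lemma₁ p ⟩
      4 * n * ((1 + (p + p)) * (3 + (p + p)))           ≤⟨ ℕ.*-monoʳ-≤ (4 * n) (ℕ.n≤1+n _) ⟩
      4 * n * suc ((1 + (p + p)) * (3 + (p + p)))       ≡⟨ cong (4 * n *_) (lemma₂ p) ⟩
      4 * n * (4 * (suc p * suc p))                     ≡⟨ lemma₃ n (suc p) ⟩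
      suc p * suc p * 16 * n                            ∎))
    where
    open ℕ.≤-Reasoning
    n = suc (p + p)
    b = binomial (suc p) (suc p)
    pow : 4 ^ (suc p + suc p) ≡ 16 * 4 ^ (p + p)
    pow = trans (cong (λ e → 4 ^ suc e) (ℕ.+-suc p p)) (sym (ℕ.*-assoc 4 4 (4 ^ (p + p))))
    lemma₁ : ∀ p → 2 * suc (p + p) * (2 * suc (p + p)) * suc (suc p + suc p) ≡
                   4 * suc (p + p) * ((1 + (p + p)) * (3 + (p + p)))
    lemma₁ = ℕSolver.solve-∀
    lemma₂ : ∀ p → suc ((1 + (p + p)) * (3 + (p + p))) ≡ 4 * (suc p * suc p)
    lemma₂ = ℕSolver.solve-∀
    lemma₃ : ∀ n s → 4 * n * (4 * (s * s)) ≡ s * s * 16 * n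
    lemma₃ = ℕSolver.solve-∀

  centralBound-≥ : ∀ i q → CentralBound (i + q) q
  centralBound-≥ zero    q = centralBound-diagonal q
  centralBound-≥ (suc i) q = centralBound-suc (i + q) q (ℕ.m≤n+m q i) (centralBound-≥ i q)

  centralBound : ∀ p q → CentralBound p q
  centralBound p q with ℕ.≤-total q p
  ... | inj₁ q≤p = subst (λ p → CentralBound p q) (ℕ.m∸n+n≡m q≤p) (centralBound-≥ (p ℕ.∸ q) q)
  ... | inj₂ p≤q rewrite binomial-comm p q | ℕ.+-comm p q =
    subst (λ q → CentralBound q p) (ℕ.m∸n+n≡m p≤q) (centralBound-≥ (q ℕ.∸ p) p)

  nCk²*[1+n]≤4^n : ∀ n k → (n C k) * (n C k) * suc n ≤ 4 ^ n
  nCk²*[1+n]≤4^n n k with k ℕ.≤? n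
  ... | yes k≤n = subst (λ n → (n C k) * (n C k) * suc n ≤ 4 ^ n) (ℕ.m+[n∸m]≡n k≤n) (centralBound k (n ℕ.∸ k))
  -- This case occurs: in `count-degree`, k is ∣ d + n ∣ / 2, which exceeds n for large d.
  ... | no  k≰n rewrite k>n⇒nCk≡0 (ℕ.≰⇒> k≰n) = z≤n

  square-cancel-≤ : ∀ {m n} → m * m ≤ n * n → m ≤ n
  square-cancel-≤ h = ℕ.≮⇒≥ λ n<m → ℕ.<⇒≱ (ℕ.*-mono-< n<m n<m) h

  -- An integer r with r² ≤ n stands in for √n.
  nCk-small : ∀ r n k → r * r ≤ n → r * (n C k) ≤ 2 ^ n
  nCk-small r n k r²≤n = square-cancel-≤ (begin
    r * (n C k) * (r * (n C k))       ≡⟨ lemma r (n C k) ⟩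
    (n C k) * (n C k) * (r * r)       ≤⟨ ℕ.*-monoʳ-≤ ((n C k) * (n C k)) (ℕ.m≤n⇒m≤1+n r²≤n) ⟩
    (n C k) * (n C k) * suc n         ≤⟨ nCk²*[1+n]≤4^n n k ⟩
    4 ^ n                             ≡⟨ ℕ.^-*-assoc 2 2 n ⟩
    2 ^ (2 * n)                       ≡⟨ cong (λ m → 2 ^ (n + m)) (ℕ.+-identityʳ n) ⟩
    2 ^ (n + n)                       ≡⟨ ℕ.^-distribˡ-+-* 2 n n ⟩
    2 ^ n * 2 ^ n                     ∎)
    where
    open ℕ.≤-Reasoning
    lemma : ∀ r c → r * c * (r * c) ≡ c * c * (r * r)
    lemma = ℕSolver.solve-∀

  -- Words of small degree have density zero

  count-degree : ∀ r n d → r * r ≤ n → r * count (λ t → deg t ℤ.≟ d) (words n) ≤ 2 ^ n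
  count-degree r n d r²≤n = begin
    r * count (λ t → deg t ℤ.≟ d) (words n)    ≤⟨ ℕ.*-monoʳ-≤ r (count-mono _ _ (words n) sameUps) ⟩
    r * count (λ t → ups t ℕ.≟ k) (words n)    ≡⟨ cong (r *_) (count-ups n k) ⟩
    r * (n C k)                                ≤⟨ nCk-small r n k r²≤n ⟩
    2 ^ n                                      ∎
    where
    open ℕ.≤-Reasoning
    k = ∣ d ℤ.+ + n ∣ / 2
    sameUps : ∀ {t} → t ∈ words n → deg t ≡ d → ups t ≡ k
    sameUps {t} t∈ = ups-deg {t = t} (length-∈-words n t∈)

  small? : ∀ N (t : Presentation) → Dec (∣ deg t ∣ < N)
  small? N t = ∣ deg t ∣ ℕ.<? N

  -- Union bound over the degrees of absolute value below N. Degree 0 is counted twice, as + 0 and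
  -- as - 0, hence N + N.
  count-small-words : ∀ r n N → r * r ≤ n → r * count (small? N) (words n) ≤ (N + N) * 2 ^ n
  count-small-words r n zero    r²≤n = ℕ.≤-reflexive (trans
    (cong (r *_) (count-none (small? 0) (λ _ ()) (words n))) (ℕ.*-zeroʳ r))
  count-small-words r n (suc N) r²≤n = begin
    r * count (small? (suc N)) ws
      ≤⟨ ℕ.*-monoʳ-≤ r (count-⊎ (small? (suc N)) ±N? (small? N) ws split) ⟩
    r * (count ±N? ws + count (small? N) ws)
      ≤⟨ ℕ.*-monoʳ-≤ r (ℕ.+-monoˡ-≤ _ (count-⊎ ±N? +N? -N? ws (λ _ → id))) ⟩
    r * (count +N? ws + count -N? ws + count (small? N) ws)
      ≡⟨ lemma₁ r (count +N? ws) (count -N? ws) (count (small? N) ws) ⟩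
    r * count +N? ws + r * count -N? ws + r * count (small? N) ws
      ≤⟨ ℕ.+-mono-≤ (ℕ.+-mono-≤ (count-degree r n (+ N) r²≤n) (count-degree r n (ℤ.- + N) r²≤n))
                    (count-small-words r n N r²≤n) ⟩
    2 ^ n + 2 ^ n + (N + N) * 2 ^ n
      ≡⟨ lemma₂ (2 ^ n) N ⟩
    (suc N + suc N) * 2 ^ n ∎
    where
    open ℕ.≤-Reasoning
    ws = words n
    +N? : ∀ t → Dec (deg t ≡ + N)
    +N? t = deg t ℤ.≟ + N
    -N? : ∀ t → Dec (deg t ≡ ℤ.- + N)
    -N? t = deg t ℤ.≟ ℤ.- + N
    ±N? : ∀ t → Dec (deg t ≡ + N ⊎ deg t ≡ ℤ.- + N)
    ±N? t = +N? t ⊎-dec -N? t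
    lemma₁ : ∀ r x y z → r * (x + y + z) ≡ r * x + r * y + r * z
    lemma₁ = ℕSolver.solve-∀
    lemma₂ : ∀ x N → x + x + (N + N) * x ≡ (suc N + suc N) * x
    lemma₂ = ℕSolver.solve-∀
    split : ∀ t → ∣ deg t ∣ < suc N → (deg t ≡ + N ⊎ deg t ≡ ℤ.- + N) ⊎ ∣ deg t ∣ < N
    split t h with ℕ.m≤n⇒m<n∨m≡n (ℕ.s≤s⁻¹ h)
    ... | inj₁ lt = inj₂ lt
    ... | inj₂ eq = inj₁ (subst (λ n → deg t ≡ + n ⊎ deg t ≡ ℤ.- + n) eq (sign (deg t)))
      where
      sign : ∀ z → z ≡ + ∣ z ∣ ⊎ z ≡ ℤ.- + ∣ z ∣
      sign (+ n)    = inj₁ refl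
      sign -[1+ n ] = inj₂ refl

  -- The estimate for a single length requires at least r² letters. Strings of length at most n₀ are
  -- bounded by their total number, a constant once r is fixed, and the induction adds the longer
  -- lengths.
  count-small-words≤ : ∀ r N i → let n₀ = r * r in
    r * count (small? N) (words≤ (i + n₀)) ≤ r * size n₀ + (N + N) * size (i + n₀)
  count-small-words≤ r N zero    = ℕ.≤-trans
    (ℕ.*-monoʳ-≤ r (List.length-filter (small? N) (words≤ (r * r)))) (ℕ.m≤m+n _ _)
  count-small-words≤ r N (suc i) = begin
    r * count (small? N) (words (suc s) ++ words≤ s)
      ≡⟨ cong (r *_) (count-++ (small? N) (words (suc s)) (words≤ s)) ⟩
    r * (count (small? N) (words (suc s)) + count (small? N) (words≤ s))
      ≡⟨ ℕ.*-distribˡ-+ r _ _ ⟩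
    r * count (small? N) (words (suc s)) + r * count (small? N) (words≤ s)
      ≤⟨ ℕ.+-mono-≤ (count-small-words r (suc s) N (ℕ.m≤n+m n₀ (suc i))) (count-small-words≤ r N i) ⟩
    (N + N) * 2 ^ suc s + (r * size n₀ + (N + N) * size s)
      ≡⟨ lemma (N + N) (2 ^ suc s) (r * size n₀) (size s) ⟩
    r * size n₀ + (N + N) * (2 ^ suc s + size s)
      ≡⟨ cong (λ z → r * size n₀ + (N + N) * z) (size-suc s) ⟨
    r * size n₀ + (N + N) * size (suc s) ∎
    where
    open ℕ.≤-Reasoning
    n₀ = r * r
    s = i + n₀
    lemma : ∀ c x y z → c * x + (y + c * z) ≡ y + c * (x + z)
    lemma = ℕSolver.solve-∀

  -- f s / size s → 0, with ε = 1 / M.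
  Negligible : (ℕ → ℕ) → Set
  Negligible f = ∀ M → ∃[ N ] ∀ s → N ≤ s → M * f s ≤ size s

  small-negligible : ∀ N → Negligible (count (small? N) ∘ words≤)
  -- From n₀ on the estimate applies; from `r * size n₀` on, `size s` also absorbs the constant
  -- term.
  small-negligible N M = n₀ + r * size n₀ , bound
    where
    open ℕ.≤-Reasoning
    -- The right-hand side becomes `size s` for the short strings plus `(N + N) * size s`, which is
    -- `k * size s`; the factor k in r is there to cancel it.
    k = suc (N + N)
    r = k * M
    n₀ = r * r
    bound : ∀ s → n₀ + r * size n₀ ≤ s → M * count (small? N) (words≤ s) ≤ size s
    bound s h = ℕ.*-cancelˡ-≤ k (begin
      k * (M * count (small? N) (words≤ s))     ≡⟨ ℕ.*-assoc k M _ ⟨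
      r * count (small? N) (words≤ s)           ≤⟨ tail ⟩
      r * size n₀ + (N + N) * size s            ≤⟨ ℕ.+-monoˡ-≤ _ head≤ ⟩
      size s + (N + N) * size s                 ∎)
      where
      tail : r * count (small? N) (words≤ s) ≤ r * size n₀ + (N + N) * size s
      tail = subst (λ s → r * count (small? N) (words≤ s) ≤ r * size n₀ + (N + N) * size s)
        (ℕ.m∸n+n≡m (ℕ.≤-trans (ℕ.m≤m+n n₀ _) h)) (count-small-words≤ r N (s ℕ.∸ n₀))
      head≤ : r * size n₀ ≤ size s
      head≤ = ℕ.≤-trans (ℕ.m≤n+m _ n₀) (ℕ.≤-trans h (ℕ.<⇒≤ (size> s)))

open Counting
open import Data.Nat.Base using (_≤_)
open import Data.Rational.Base using (_/_)

-- Proportions and their limits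

size-nonZero : ∀ s → NonZero (size s)
size-nonZero s = ℕ.>-nonZero (ℕ.≤-<-trans z≤n (size> s))

proportion : (ℕ → ℕ) → ℕ → ℚ
proportion f s = (+ f s / size s) {{size-nonZero s}}

words≤-counts : ∀ s → HasCardinality (λ (t : Presentation) → length t ≤ s) (size s)
words≤-counts s =
  words≤ s , words≤-unique s , (λ t → mk⇔ (length-∈-words≤ s) (∈-words≤ s)) , refl

filter-counts : {P : Pred Presentation ℓ} (P? : Decidable P) → ∀ s →
  HasCardinality (λ t → length t ≤ s × P t) (count P? (words≤ s))
filter-counts P? s =
    filter P? (words≤ s)
  , Unique.filter⁺ P? (words≤-unique s)
  , (λ t → mk⇔ (Product.map₁ (length-∈-words≤ s) ∘ ∈-filter⁻ P?)
               (λ (h , p) → ∈-filter⁺ P? (∈-words≤ s h) p))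
  , refl

toℚᵘ-/ : ∀ x n → toℚᵘ (+ x / suc n) ℚᵘ.≃ mkℚᵘ (+ x) n
toℚᵘ-/ x n = ℚ.toℚᵘ-fromℚᵘ (mkℚᵘ (+ x) n)

-- A positive ε is at least one over its denominator; the extra one in `suc (ℚ.↧ₙ ε)` makes the
-- inequality strict.
/-small : ∀ x n {ε} .{{_ : NonZero n}} →
  0ℚ ℚ.< ε → suc (ℚ.↧ₙ ε) ℕ.* x ≤ n → + x / n ℚ.< ε
/-small x (suc n) {mkℚ (+ zero) d-1 c} ε>0 h = contradiction (ℚ.drop-*<* ε>0) (ℤ.<-irrefl refl)
/-small x (suc n) {mkℚ (ℤ.-[1+ k ]) d-1 c} ε>0 h with ℚ.drop-*<* ε>0
... | ()
/-small x (suc n) {mkℚ (+ suc k) d-1 c} ε>0 h = ℚ.toℚᵘ-cancel-<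
  (ℚᵘ.<-respˡ-≃ (ℚᵘ.≃-sym (toℚᵘ-/ x n))
    (*<* (subst (ℤ._< + suc k ℤ.* + suc n) (ℤ.pos-* x (suc d-1)) (ℤ.+<+ (cross x h)))))
  where
  open ℕ.≤-Reasoning
  cross : ∀ x → suc (suc d-1) ℕ.* x ≤ suc n → x ℕ.* suc d-1 ℕ.< suc k ℕ.* suc n
  -- For x = 0 the extra one gains nothing, and strictness comes from the positive numerator of ε.
  cross zero    h = s≤s z≤n
  cross x@(suc _) h = begin-strict
    x ℕ.* suc d-1              ≡⟨ ℕ.*-comm x (suc d-1) ⟩
    suc d-1 ℕ.* x              <⟨ ℕ.m<n+m (suc d-1 ℕ.* x) (s≤s z≤n) ⟩
    suc (suc d-1) ℕ.* x        ≤⟨ h ⟩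
    suc n                      ≤⟨ ℕ.m≤m+n (suc n) _ ⟩
    suc k ℕ.* suc n            ∎

∣/∣ : ∀ x n .{{_ : NonZero n}} → ℚ.∣ + x / n ∣ ≡ + x / n
∣/∣ x n = ℚ.0≤p⇒∣p∣≡p (ℚ.nonNegative⁻¹ (+ x / n) {{ℚ.normalize-nonNeg x n}})

/-+-/ : ∀ x y n .{{_ : NonZero n}} → x ℕ.+ y ≡ n → (+ x / n) ℚ.+ (+ y / n) ≡ 1ℚ
/-+-/ x y (suc n) eq = ℚ.toℚᵘ-injective (begin
  toℚᵘ ((+ x / suc n) ℚ.+ (+ y / suc n))         ≈⟨ ℚ.toℚᵘ-homo-+ (+ x / suc n) (+ y / suc n) ⟩
  toℚᵘ (+ x / suc n) ℚᵘ.+ toℚᵘ (+ y / suc n)     ≈⟨ ℚᵘ.+-cong (toℚᵘ-/ x n) (toℚᵘ-/ y n) ⟩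
  mkℚᵘ (+ x) n ℚᵘ.+ mkℚᵘ (+ y) n                 ≈⟨ *≡* cross ⟩
  ℚᵘ.1ℚᵘ                                         ∎)
  where
  open import Relation.Binary.Reasoning.Setoid ℚᵘ.≃-setoid
  cross : (+ x ℤ.* + suc n ℤ.+ + y ℤ.* + suc n) ℤ.* + 1 ≡ + 1 ℤ.* (+ (suc n ℕ.* suc n))
  cross = trans (ℤ.*-identityʳ _) (trans (sym (ℤ.*-distribʳ-+ (+ suc n) (+ x) (+ y)))
    (trans (cong (λ m → + m ℤ.* + suc n) eq)
      (trans (sym (ℤ.pos-* (suc n) (suc n))) (sym (ℤ.*-identityˡ _)))))

∣/-1∣ : ∀ x y n .{{_ : NonZero n}} → x ℕ.+ y ≡ n → ℚ.∣ (+ x / n) ℚ.- 1ℚ ∣ ≡ + y / n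
∣/-1∣ x y n eq = trans (cong ℚ.∣_∣ p-1≡-q) (trans (ℚ.∣-p∣≡∣p∣ q) (∣/∣ y n))
  where
  open ≡-Reasoning
  p = + x / n
  q = + y / n
  p-1≡-q : p ℚ.- 1ℚ ≡ ℚ.- q
  p-1≡-q = begin
    p ℚ.- 1ℚ                    ≡⟨ cong (λ r → p ℚ.- r) (/-+-/ x y n eq) ⟨
    p ℚ.- (p ℚ.+ q)             ≡⟨ cong (p ℚ.+_) (ℚ.neg-distrib-+ p q) ⟩
    p ℚ.+ (ℚ.- p ℚ.+ ℚ.- q)     ≡⟨ ℚ.+-assoc p (ℚ.- p) (ℚ.- q) ⟨
    (p ℚ.- p) ℚ.+ ℚ.- q         ≡⟨ cong (ℚ._+ ℚ.- q) (ℚ.+-inverseʳ p) ⟩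
    0ℚ ℚ.+ ℚ.- q                ≡⟨ ℚ.+-identityˡ (ℚ.- q) ⟩
    ℚ.- q                       ∎

negligible-mono : ∀ {f g} → (∀ s → f s ≤ g s) → Negligible g → Negligible f
negligible-mono f≤g h M = let (N , k) = h M in
  N , λ s N≤s → ℕ.≤-trans (ℕ.*-monoʳ-≤ M (f≤g s)) (k s N≤s)

negligible⇒⟶0 : ∀ {f} → Negligible f → proportion f ⟶ 0ℚ
negligible⇒⟶0 {f} h ε ε>0 with h (suc (ℚ.↧ₙ ε))
... | N , k = N , λ s N≤s → let instance _ = size-nonZero s in subst (ℚ._< ε)
  (sym (trans (cong ℚ.∣_∣ (ℚ.+-identityʳ (+ f s / size s))) (∣/∣ (f s) (size s))))
  (/-small (f s) (size s) ε>0 (k s N≤s))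

conegligible⇒⟶1 : ∀ {f g} → (∀ s → f s ℕ.+ g s ≡ size s) → Negligible g → proportion f ⟶ 1ℚ
conegligible⇒⟶1 {f} {g} f+g h ε ε>0 with h (suc (ℚ.↧ₙ ε))
... | N , k = N , λ s N≤s → let instance _ = size-nonZero s in subst (ℚ._< ε)
  (sym (∣/-1∣ (f s) (g s) (size s) (f+g s)))
  (/-small (g s) (size s) ε>0 (k s N≤s))

-- The density of a sentence

density : ∀ φ {d} → proportion (count (presented⊨? φ) ∘ words≤) ⟶ d →
  HasLimitingDensity φ d
density φ limit = record
  { P         = size
  ; Pφ        = count (presented⊨? φ) ∘ words≤
  ; P-counts  = words≤-counts
  ; Pφ-counts = filter-counts (presented⊨? φ)
  ; P-nonZero = λ {s} → size-nonZero s
  ; limit     = limit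
  }

-- Contrapositive of `presented⇔ℤ`: an exception has degree below the threshold. The exceptions are
-- the t falsifying φ if ℤ satisfies φ, and those satisfying φ otherwise.
exceptional-negligible : ∀ φ {P : Pred Presentation ℓ} (P? : Decidable P) →
  (∀ t → P t → ¬ (presented t ⊨ φ ⇔ ℤ-structure ⊨ φ)) → Negligible (count P? ∘ words≤)
exceptional-negligible φ P? h = negligible-mono
  (λ s → count-mono P? (small? (threshold φ)) (words≤ s)
    λ {t} _ p → ℕ.≰⇒> λ large → h t p (presented⇔ℤ φ t large))
  (small-negligible (threshold φ))

theorem3p9 : (φ : Sentence) → ∃[ d ] HasLimitingDensity φ d × (ℤ-structure ⊨ φ → d ≡ 1ℚ) × (¬ (ℤ-structure ⊨ φ) → d ≡ 0ℚ)
theorem3p9 φ with ℤ⊨? φ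
... | yes ℤ⊨φ = 1ℚ
  , density φ (conegligible⇒⟶1 {g = count (¬? ∘ presented⊨? φ) ∘ words≤}
      (λ s → count-complement (presented⊨? φ) (words≤ s))
      (exceptional-negligible φ (¬? ∘ presented⊨? φ) λ t ¬⊨ e → ¬⊨ (from e ℤ⊨φ)))
  , (λ _ → refl)
  , (λ ¬ℤ⊨φ → contradiction ℤ⊨φ ¬ℤ⊨φ)
... | no ¬ℤ⊨φ = 0ℚ
  , density φ (negligible⇒⟶0
      (exceptional-negligible φ (presented⊨? φ) λ t ⊨φ e → ¬ℤ⊨φ (to e ⊨φ)))
  , (λ ℤ⊨φ → contradiction ℤ⊨φ ¬ℤ⊨φ)
  , (λ _ → refl)
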